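{- For $d \geq 1$, the class $\{F \mid \Delta(F) \leq d\}^{\oplus 1}$ of $1$-sums of graphs of maximum degree $\leq d$ is closed under weak oddomorphisms and homomorphism distinguishing closed. In particular, the class of cactus graphs ($d = 2$) is closed under weak oddomorphisms and homomorphism distinguishing closed.
   Context: All graphs are finite, simple and loopless; $\Delta(F)$ is the maximum degree. For $X\subseteq V(G)$, the torso of $G$ on $X$ has vertex set $X$ and edges those of $G$ inside $X$ plus all pairs $xy$ with $x,y\in N_G(C)$ for a connected component $C$ of $G-X$. For a class $\mathcal{C}$, $\mathcal{C}^{\oplus 1}$ is the class of graphs $G$ with a tree decomposition $(T,\beta)$ such that $|\beta(t)\cap\beta(t')|\leq 1$ for every $tt'\in E(T)$ and the torso of $G$ on $\beta(t)$ lies in $\mathcal{C}$ for every $t\in V(T)$. For a homomorphism $\phi\colon F\to G$, a vertex $a$ is odd (even) if $|N_F(a)\cap\phi^{ -1}(v)|$ is odd (even) for all $v\in N_G(\phi(a))$; $\phi$ is an oddomorphism if every vertex is odd or even and each fibre contains an odd number of odd vertices; a weak oddomorphism is a homomorphism whose restriction to some subgraph of $F$ is an oddomorphism. A class $\mathcal{F}$ is closed under weak oddomorphisms if $F\in\mathcal{F}$ and a weak oddomorphism $F\to G$ imply $G\in\mathcal{F}$. $\mathcal{F}$ is homomorphism distinguishing closed if for every graph $F'\notin\mathcal{F}$ there exist graphs $G,H$ with $\hom(F,G)=\hom(F,H)$ for all $F\in\mathcal{F}$ but $\hom(F',G)\neq\hom(F',H)$. A cactus graph is a graph in which any two simple cycles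 share at most one vertex. -}

module Defs where

open import Data.Nat using (ℕ; zero; suc; _+_; _≤_; _<?_; _%_)
open import Data.Fin using (Fin; zero; suc; toℕ; fromℕ<)
open import Data.Bool using (Bool; true; false; _∧_; if_then_else_)
open import Data.List using (List; []; _∷_; map; concatMap; length; filter)
open import Data.Product using (Σ; ∃; _×_; _,_)
open import Data.Sum using (_⊎_)
open import Relation.Nullary using (¬_; yes; no)
open import Relation.Binary.PropositionalEquality using (_≡_; _≢_)
open import Function.Definitions using (Injective)
open import Data.Bool using (_≟_)

record Graph : Set where
  field
    n     : ℕ
    adj   : Fin n → Fin n → Bool
    sym   : ∀ a b → adj a b ≡ adj b a
    loopless : ∀ a → adj a a ≡ false
open Graph public

V : Graph → Set
V G = Fin (n G)

GraphClass : Set₁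
GraphClass = Graph → Set

count : ∀ {k} → (Fin k → Bool) → ℕ
count {zero}  p = 0
count {suc k} p = (if p zero then 1 else 0) + count (λ i → p (suc i))

Odd : ℕ → Set
Odd m = m % 2 ≡ 1

Even : ℕ → Set
Even m = m % 2 ≡ 0

degree : (G : Graph) → V G → ℕ
degree G a = count (adj G a)

MaxDegLe : ℕ → GraphClass
MaxDegLe d F = ∀ a → degree F a ≤ d

IsHom : (F G : Graph) → (V F → V G) → Set
IsHom F G φ = ∀ a b → adj F a b ≡ true → adj G (φ a) (φ b) ≡ true

allFin : ∀ k → List (Fin k)
allFin zero = []
allFin (suc k) = zero ∷ map suc (allFin k)

allB : ∀ {A : Set} → (A → Bool) → List A → Bool
allB p [] = true
allB p (x ∷ xs) = p x ∧ allB p xs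

implB : Bool → Bool → Bool
implB true b = b
implB false _ = true

isHomB : (F G : Graph) → (V F → V G) → Bool
isHomB F G φ = allB (λ a → allB (λ b → implB (adj F a b) (adj G (φ a) (φ b))) (allFin (n F))) (allFin (n F))

allFuns : ∀ k m → List (Fin k → Fin m)
allFuns zero m = (λ ()) ∷ []
allFuns (suc k) m =
  concatMap (λ x → map (λ f → λ { zero → x ; (suc i) → f i }) (allFuns k m)) (allFin m)

hom : Graph → Graph → ℕ
hom F G = length (filter (λ φ → isHomB F G φ ≟ true) (allFuns (n F) (n G)))

record Subgraph (F : Graph) : Set where
  field
    inV  : V F → Bool
    inE  : V F → V F → Bool
    E⊆   : ∀ a b → inE a b ≡ true → adj F a b ≡ true
    Esym : ∀ a b → inE a b ≡ inE b a
    Eend : ∀ a b → inE a b ≡ true → inV a ≡ true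
open Subgraph public

fullSubgraph : (F : Graph) → Subgraph F
fullSubgraph F = record
  { inV = λ _ → true ; inE = adj F ; E⊆ = λ _ _ e → e
  ; Esym = sym F ; Eend = λ _ _ _ → _≡_.refl }

eqF : ∀ {k} → Fin k → Fin k → Bool
eqF zero zero = true
eqF zero (suc _) = false
eqF (suc _) zero = false
eqF (suc i) (suc j) = eqF i j

nbrsInFibre : (F G : Graph) (S : Subgraph F) (φ : V F → V G) → V F → V G → ℕ
nbrsInFibre F G S φ a v = count (λ b → inV S b ∧ (inE S a b ∧ eqF (φ b) v))

IsOddVertex : (F G : Graph) (S : Subgraph F) (φ : V F → V G) → V F → Set
IsOddVertex F G S φ a = ∀ v → adj G (φ a) v ≡ true → Odd (nbrsInFibre F G S φ a v)

IsEvenVertex : (F G : Graph) (S : Subgraph F) (φ : V F → V G) → V F → Set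
IsEvenVertex F G S φ a = ∀ v → adj G (φ a) v ≡ true → Even (nbrsInFibre F G S φ a v)

isOddB : (F G : Graph) (S : Subgraph F) (φ : V F → V G) → V F → Bool
isOddB F G S φ a =
  allB (λ v → implB (adj G (φ a) v) (eqN (nbrsInFibre F G S φ a v % 2) 1)) (allFin (n G))
  where
  eqN : ℕ → ℕ → Bool
  eqN zero zero = true
  eqN zero (suc _) = false
  eqN (suc _) zero = false
  eqN (suc x) (suc y) = eqN x y

-- φ restricted to the subgraph F' is an oddomorphism F' → G
-- (φ is assumed to be a homomorphism F → G, hence also F' → G)
IsOddoOn : (F G : Graph) (S : Subgraph F) (φ : V F → V G) → Set
IsOddoOn F G S φ =
  (∀ a → inV S a ≡ true → IsOddVertex F G S φ a ⊎ IsEvenVertex F G S φ a)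
  × (∀ v → Odd (count (λ a → inV S a ∧ (eqF (φ a) v ∧ isOddB F G S φ a))))

IsOddomorphism : (F G : Graph) → (V F → V G) → Set
IsOddomorphism F G φ = IsHom F G φ × IsOddoOn F G (fullSubgraph F) φ

IsWeakOddomorphism : (F G : Graph) → (V F → V G) → Set
IsWeakOddomorphism F G φ = IsHom F G φ × Σ (Subgraph F) (λ S → IsOddoOn F G S φ)

ClosedUnderWeakOddomorphisms : GraphClass → Set
ClosedUnderWeakOddomorphisms 𝓕 =
  ∀ F G (φ : V F → V G) → 𝓕 F → IsWeakOddomorphism F G φ → 𝓕 G

HomDistClosed : GraphClass → Set
HomDistClosed 𝓕 =
  ∀ F' → ¬ 𝓕 F' →
  Σ Graph λ G → Σ Graph λ H →
    (∀ F → 𝓕 F → hom F G ≡ hom F H) × (hom F' G ≢ hom F' H)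

VSet : Graph → Set
VSet G = V G → Bool

data Walk (G : Graph) (S : VSet G) : V G → V G → Set where
  here : ∀ {u} → S u ≡ true → Walk G S u u
  step : ∀ {u w v} → S u ≡ true → adj G u w ≡ true → Walk G S w v → Walk G S u v

ConnectedOn : (G : Graph) → VSet G → Set
ConnectedOn G S = ∀ u v → S u ≡ true → S v ≡ true → Walk G S u v

Connected : Graph → Set
Connected G = ConnectedOn G (λ _ → true)

IsComponentOf : (G : Graph) (X C : VSet G) → Set
IsComponentOf G X C =
  (∀ v → C v ≡ true → X v ≡ false)
  × (∃ λ v → C v ≡ true)
  × ConnectedOn G C
  × (∀ u v → C u ≡ true → adj G u v ≡ true → X v ≡ false → C v ≡ true)

InNbhd : (G : Graph) (C : VSet G) → V G → Set
InNbhd G C x = C x ≡ false × (∃ λ c → C c ≡ true × adj G c x ≡ true)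

TorsoAdj : (G : Graph) (X : VSet G) → V G → V G → Set
TorsoAdj G X x y =
  X x ≡ true × X y ≡ true × x ≢ y ×
  (adj G x y ≡ true
   ⊎ Σ (VSet G) (λ C → IsComponentOf G X C × InNbhd G C x × InNbhd G C y))

IsTorso : (G : Graph) (X : VSet G) (H : Graph) → Set
IsTorso G X H =
  Σ (V H → V G) λ e →
    Injective _≡_ _≡_ e
    × (∀ v → X v ≡ true → ∃ λ i → e i ≡ v)
    × (∀ i → X (e i) ≡ true)
    × (∀ i j → (adj H i j ≡ true → TorsoAdj G X (e i) (e j))
               × (TorsoAdj G X (e i) (e j) → adj H i j ≡ true))

TorsoIn : GraphClass → (G : Graph) → VSet G → Set
TorsoIn 𝓒 G X = Σ Graph λ H → IsTorso G X H × 𝓒 H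

next : ∀ {m} → Fin (suc m) → Fin (suc m)
next {m} i with suc (toℕ i) <? suc m
... | yes p = fromℕ< p
... | no _  = zero

record Cycle (G : Graph) : Set where
  field
    len  : ℕ
    cv   : Fin (3 + len) → V G
    inj  : Injective _≡_ _≡_ cv
    edge : ∀ i → adj G (cv i) (cv (next i)) ≡ true
open Cycle public

OnCycle : {G : Graph} → Cycle G → V G → Set
OnCycle C a = ∃ λ i → cv C i ≡ a

CycleEdge : {G : Graph} → Cycle G → V G → V G → Set
CycleEdge C a b = ∃ λ i → (cv C i ≡ a × cv C (next i) ≡ b) ⊎ (cv C i ≡ b × cv C (next i) ≡ a)

Acyclic : Graph → Set
Acyclic G = ¬ Cycle G

IsTree : Graph → Set
IsTree T = (1 ≤ n T) × Connected T × Acyclic T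

-- any two (distinct) simple cycles share at most one vertex:
-- two cycles sharing two distinct vertices have the same edge set (are the same cycle)
Cactus : GraphClass
Cactus G =
  ∀ (C₁ C₂ : Cycle G) (u v : V G) → u ≢ v →
    OnCycle C₁ u → OnCycle C₁ v → OnCycle C₂ u → OnCycle C₂ v →
    ∀ a b → (CycleEdge C₁ a b → CycleEdge C₂ a b) × (CycleEdge C₂ a b → CycleEdge C₁ a b)

record TreeDecomposition (G : Graph) : Set where
  field
    T      : Graph
    tree   : IsTree T
    β      : V T → VSet G
    coverV : ∀ v → ∃ λ t → β t v ≡ true
    coverE : ∀ u v → adj G u v ≡ true → ∃ λ t → β t u ≡ true × β t v ≡ true
    connV  : ∀ v → ConnectedOn T (λ t → β t v)
open TreeDecomposition public

OneSums : GraphClass → GraphClass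
OneSums 𝓒 G = Σ (TreeDecomposition G) λ D →
  (∀ t t' → adj (T D) t t' ≡ true → count (λ v → β D t v ∧ β D t' v) ≤ 1)
  × (∀ t → TorsoIn 𝓒 G (β D t))

{-# OPTIONS --safe #-}
module Submission where

-- Both classes are described by fans: m neighbours of a vertex v in a common component of
-- G − v. The 1-sums of graphs of maximum degree ≤ d are the graphs without a fan of size
-- d + 1, i.e. those whose blocks have maximum degree ≤ d, and for d = 2 these are the cacti.
--
-- Let F have no such fan, let G have one at v with tips w₀, …, w_d, and let φ : V F → V G.
-- For every a₀ in the fibre of v, each component D of F − a₀ misses some fibre φ⁻¹(w_i)
-- among the neighbours of a₀. Labelling a₀ with the edge v w₀ and the vertices of D with
-- the closed walk v, w₀, …, w_i, v, and summing over a₀, solves the 𝔽₂-linear system of the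
-- lifts of φ to the CFI graph of G twisted at v. A weak oddomorphism F → G would certify
-- that this system has no solution. The solutions also show that F does not distinguish
-- the two CFI graphs of G, whereas G does, as its identity map has no twisted lift.

open import Defs
open import Data.Nat using (ℕ; zero; suc; _+_; _*_; _^_; _%_; _≤_; _<_; z≤n; s≤s; _<?_)
open import Data.Nat.Properties using (≤-trans; ≤-antisym; n≤1+n; ≮⇒≥; <⇒≱; <⇒≢; <-irrefl)
open import Data.Nat.Induction using (<-wellFounded)
open import Data.Fin using (Fin; zero; suc; toℕ; fromℕ; fromℕ<; inject₁; inject≤; combine; remQuot; finToFun; funToFin)
open import Data.Fin.Properties using (_≟_; any?; all?; suc-injective; injective⇒≤; inject≤-injective; toℕ-injective; toℕ-fromℕ; toℕ-fromℕ<; toℕ-inject₁; toℕ<n; remQuot-combine; combine-remQuot; finToFun-funToFin; funToFin-finToFin)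
open import Data.Fin.Induction using (<-weakInduction; >-weakInduction)
open import Data.Fin.Relation.Unary.Top using (view; ‵fromℕ; ‵inject₁)
open import Data.Bool using (Bool; true; false; _∧_; _∨_; _xor_; not; if_then_else_)
import Data.Bool.Properties as Bool
open import Data.List using (List; []; _∷_; length; lookup; filter)
open import Data.List.Membership.Propositional using (_∈_; _∉_)
open import Data.List.Membership.Propositional.Properties using (∈-map⁺; ∈-lookup)
open import Data.List.Membership.Setoid.Properties using (∈-filter⁺)
open import Data.List.Relation.Unary.Any using (Any; here; there)
import Data.List.Relation.Unary.Any as Any
import Data.List.Relation.Unary.Any.Properties as Any
open import Data.List.Relation.Unary.All using ([]; _∷_)
import Data.List.Relation.Unary.All as All
import Data.List.Relation.Unary.All.Properties as All
open import Data.List.Relation.Unary.AllPairs using (AllPairs; []; _∷_)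
import Data.List.Relation.Unary.AllPairs as AllPairs
import Data.List.Relation.Unary.AllPairs.Properties as AllPairs
open import Data.Product using (Σ; ∃; _×_; _,_; proj₁; proj₂)
open import Data.Sum using (_⊎_; inj₁; inj₂)
open import Data.Empty using (⊥; ⊥-elim)
open import Relation.Nullary using (¬_; Dec; yes; no; does; contradiction)
open import Relation.Nullary.Decidable using (_×-dec_; _⊎-dec_; _→-dec_; ¬?; map′; dec-true; dec-false; does-⇔; decidable-stable)
open import Relation.Binary.PropositionalEquality using (_≡_; _≢_; _≗_; refl; trans; cong; cong₂; subst; ≢-sym; _→-setoid_; module ≡-Reasoning) renaming (sym to ≡-sym)
open import Relation.Binary.Construct.Closure.ReflexiveTransitive using (Star; ε; _◅_; _◅◅_)
open import Induction.WellFounded using (Acc; acc)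
open import Function using (_∘_; id)
open import Function.Bundles using (mk⇔)
open import Function.Definitions using (Injective)
open import Algebra.Bundles using (CommutativeRing)
open import Algebra.Properties.Semiring.Sum (CommutativeRing.semiring Bool.xor-∧-commutativeRing) using (sum; sum-cong-≗; sum-replicate-zero; ∑-distrib-+; ∑-comm; *-distribˡ-sum; *-distribʳ-sum)


-- Fans make non-membership constructive: closedness under homomorphism distinguishing starts from a
-- graph that is merely not in the class, and since the existence of a fan is decidable, this yields
-- an actual fan to build on. A component D of F - a₀ misses a fibre because neighbours of a₀ lying
-- over distinct tips are distinct: if D had one over every w_i, they would form a fan of F at a₀.
-- The labels on D come from a closed walk since such a walk is even at every vertex, so D receives
-- no charge, while the lone edge v w₀ gives a₀ charge 1. The tips are linked in G - v, so at v the
-- closed walk shows only the edges v w₀ and v w_i. An edge from a₀ to b in D therefore compares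
-- [φ b = w₀] with [φ b = w₀] + [φ b = w_i], and these agree because D misses the fibre of w_i.

true≢false : ∀ {b} → b ≡ true → b ≡ false → ⊥
true≢false refl ()

∧-true : ∀ {a b} → a ≡ true → b ≡ true → a ∧ b ≡ true
∧-true refl refl = refl

∧-true⁻ : ∀ a {b} → a ∧ b ≡ true → a ≡ true × b ≡ true
∧-true⁻ true eq = refl , eq

does⁻ : {A : Set} (a? : Dec A) → does a? ≡ true → A
does⁻ (yes a) _ = a

eqF-refl : ∀ {k} (i : Fin k) → eqF i i ≡ true
eqF-refl zero    = refl
eqF-refl (suc i) = eqF-refl i

eqF⇒≡ : ∀ {k} (i j : Fin k) → eqF i j ≡ true → i ≡ j
eqF⇒≡ zero    zero    _  = refl
eqF⇒≡ (suc i) (suc j) eq = cong suc (eqF⇒≡ i j eq)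

≢⇒eqF : ∀ {k} {i j : Fin k} → i ≢ j → eqF i j ≡ false
≢⇒eqF {i = i} {j} i≢j = Bool.¬-not (i≢j ∘ eqF⇒≡ i j)

record Enumeration {k} (p : Fin k → Bool) (m : ℕ) : Set where
  field
    elem       : Fin m → Fin k
    elem-true  : ∀ i → p (elem i) ≡ true
    elem-inj   : Injective _≡_ _≡_ elem
    elem-index : ∀ x → p x ≡ true → ∃ λ i → elem i ≡ x
open Enumeration

enumerate : ∀ {k} (p : Fin k → Bool) → Enumeration p (count p)
enumerate {zero} p = record
  { elem = λ () ; elem-true = λ () ; elem-inj = λ { {()} } ; elem-index = λ () }
enumerate {suc k} p with p zero in eq | enumerate (p ∘ suc)
... | true | E = record
  { elem       = λ { zero → zero ; (suc i) → suc (elem E i) }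
  ; elem-true  = λ { zero → eq ; (suc i) → elem-true E i }
  ; elem-inj   = λ { {zero} {zero} _ → refl
                   ; {suc i} {suc j} e → cong suc (elem-inj E (suc-injective e)) }
  ; elem-index = λ { zero _ → zero , refl
                   ; (suc x) px → suc (proj₁ (elem-index E x px))
                                , cong suc (proj₂ (elem-index E x px)) }
  }
... | false | E = record
  { elem       = suc ∘ elem E
  ; elem-true  = elem-true E
  ; elem-inj   = elem-inj E ∘ suc-injective
  ; elem-index = λ { zero pz → ⊥-elim (true≢false pz eq)
                   ; (suc x) px → proj₁ (elem-index E x px)
                                , cong suc (proj₂ (elem-index E x px)) }
  }

injection⇒≤count : ∀ {m k} {p : Fin k → Bool} (f : Fin m → Fin k) →
  Injective _≡_ _≡_ f → (∀ i → p (f i) ≡ true) → m ≤ count p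
injection⇒≤count {p = p} f f-inj pf = injective⇒≤ {f = index} λ {i} {j} e →
  f-inj (trans (≡-sym (proj₂ (at i))) (trans (cong (elem (enumerate p)) e) (proj₂ (at j))))
  where
  at : ∀ i → ∃ λ j → elem (enumerate p) j ≡ f i
  at i = elem-index (enumerate p) (f i) (pf i)
  index = λ i → proj₁ (at i)

≤count⇒injection : ∀ {m k} (p : Fin k → Bool) → m ≤ count p →
  Σ (Fin m → Fin k) λ f → Injective _≡_ _≡_ f × (∀ i → p (f i) ≡ true)
≤count⇒injection p m≤ =
    (λ i → elem E (inject≤ i m≤))
  , (λ e → inject≤-injective m≤ m≤ _ _ (elem-inj E e))
  , (λ i → elem-true E (inject≤ i m≤))
  where E = enumerate p

count≤1 : ∀ {k} (p : Fin k → Bool) → (∀ x y → p x ≡ true → p y ≡ true → x ≡ y) → count p ≤ 1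
count≤1 p uniq with 1 <? count p
... | no 1≮ = ≮⇒≥ 1≮
... | yes 1< with ≤count⇒injection p 1<
... | f , f-inj , pf with () ← f-inj {zero} {suc zero} (uniq _ _ (pf zero) (pf (suc zero)))

count-strict : ∀ {k} (p q : Fin k → Bool) → (∀ i → p i ≡ true → q i ≡ true) →
  ∀ x → q x ≡ true → p x ≡ false → count p < count q
count-strict p q p⊆q x qx ¬px = injection⇒≤count f f-inj qf
  where
  E = enumerate p
  f : Fin (suc (count p)) → _
  f zero    = x
  f (suc i) = elem E i
  x≢ : ∀ i → x ≢ elem E i
  x≢ i refl = true≢false (elem-true E i) ¬px
  f-inj : Injective _≡_ _≡_ f
  f-inj {zero}  {zero}  _ = refl
  f-inj {zero}  {suc j} e = ⊥-elim (x≢ j e)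
  f-inj {suc i} {zero}  e = ⊥-elim (x≢ i (≡-sym e))
  f-inj {suc i} {suc j} e = cong suc (elem-inj E e)
  qf : ∀ i → _
  qf zero    = qx
  qf (suc i) = p⊆q _ (elem-true E i)

∈-allFin : ∀ {k} (i : Fin k) → i ∈ allFin k
∈-allFin zero    = here refl
∈-allFin (suc i) = there (∈-map⁺ suc (∈-allFin i))

-- Walks and reachability

adj⇒≢ : ∀ G {a b} → adj G a b ≡ true → a ≢ b
adj⇒≢ G {a} ab refl = true≢false ab (loopless G a)

adj-sym : ∀ G {a b} → adj G a b ≡ true → adj G b a ≡ true
adj-sym G {a} {b} ab = trans (Graph.sym G b a) ab

everywhere : {G : Graph} → VSet G
everywhere _ = true

avoid : {G : Graph} → V G → VSet G
avoid c x = not (eqF x c)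

avoid⁺ : ∀ {k} {c x : Fin k} → x ≢ c → not (eqF x c) ≡ true
avoid⁺ x≢c = cong not (≢⇒eqF x≢c)

avoid⁻ : ∀ {k} {c x : Fin k} → not (eqF x c) ≡ true → x ≢ c
avoid⁻ {x = x} av refl with eqF x x | eqF-refl x
avoid⁻ () refl | .true | refl

module _ {G : Graph} {S : VSet G} where

  walk-source : ∀ {u w} → Walk G S u w → S u ≡ true
  walk-source (here s)     = s
  walk-source (step s _ _) = s

  walk-target : ∀ {u w} → Walk G S u w → S w ≡ true
  walk-target (here s)     = s
  walk-target (step _ _ p) = walk-target p

  infixr 5 _++ʷ_
  _++ʷ_ : ∀ {u w x} → Walk G S u w → Walk G S w x → Walk G S u x
  here _      ++ʷ q = q
  step s e p ++ʷ q = step s e (p ++ʷ q)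

  edge-walk : ∀ {u w} → S u ≡ true → S w ≡ true → adj G u w ≡ true → Walk G S u w
  edge-walk su sw uw = step su uw (here sw)

  reverse-walk : ∀ {u w} → Walk G S u w → Walk G S w u
  reverse-walk (here s)     = here s
  reverse-walk (step s e p) = reverse-walk p ++ʷ edge-walk (walk-source p) s (adj-sym G e)

  walk-closed : (P : V G → Set) → (∀ {u w} → S u ≡ true → S w ≡ true → adj G u w ≡ true → P u → P w) →
    ∀ {u w} → Walk G S u w → P u → P w
  walk-closed P cl (here _)     pu = pu
  walk-closed P cl (step s e p) pu = walk-closed P cl p (cl s (walk-source p) e pu)

walk-⊆ : ∀ {G} {S S' : VSet G} → (∀ x → S x ≡ true → S' x ≡ true) → ∀ {u w} → Walk G S u w → Walk G S' u w
walk-⊆ sub (here s)     = here (sub _ s)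
walk-⊆ sub (step s e p) = step (sub _ s) e (walk-⊆ sub p)

-- Floyd–Warshall: joined through intermediate vertices from a given list.
module Reachability (G : Graph) (S : VSet G) where

  Via : List (V G) → V G → V G → Set
  Via []       u w = S u ≡ true × S w ≡ true × (u ≡ w ⊎ adj G u w ≡ true)
  Via (z ∷ zs) u w = Via zs u w ⊎ (Via zs u z × Via zs z w)

  via? : ∀ zs u w → Dec (Via zs u w)
  via? []       u w = (S u Bool.≟ true) ×-dec (S w Bool.≟ true) ×-dec ((u ≟ w) ⊎-dec (adj G u w Bool.≟ true))
  via? (z ∷ zs) u w = via? zs u w ⊎-dec (via? zs u z ×-dec via? zs z w)

  via⇒walk : ∀ zs {u w} → Via zs u w → Walk G S u w
  via⇒walk []       (su , _ , inj₁ refl)  = here su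
  via⇒walk []       (su , sw , inj₂ uw)   = edge-walk su sw uw
  via⇒walk (z ∷ zs) (inj₁ p)              = via⇒walk zs p
  via⇒walk (z ∷ zs) (inj₂ (p , q))        = via⇒walk zs p ++ʷ via⇒walk zs q

  base⇒via : ∀ zs {u w} → Via [] u w → Via zs u w
  base⇒via []       p = p
  base⇒via (z ∷ zs) p = inj₁ (base⇒via zs p)

  to-pivot : ∀ zs {z u} → Via (z ∷ zs) u z → Via zs u z
  to-pivot zs (inj₁ p)       = p
  to-pivot zs (inj₂ (p , _)) = p

  from-pivot : ∀ zs {z w} → Via (z ∷ zs) z w → Via zs z w
  from-pivot zs (inj₁ p)       = p
  from-pivot zs (inj₂ (_ , q)) = q

  -- Composition is possible only at a vertex x that is itself an allowed intermediate. If both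
  -- halves visit the pivot z, the detour from z to x and back is cut out.
  via-trans : ∀ zs {u x w} → x ∈ zs → Via zs u x → Via zs x w → Via zs u w
  via-trans (z ∷ zs) (here refl) p q = inj₂ (to-pivot zs p , from-pivot zs q)
  via-trans (z ∷ zs) (there x∈) (inj₁ p) (inj₁ q) = inj₁ (via-trans zs x∈ p q)
  via-trans (z ∷ zs) (there x∈) (inj₁ p) (inj₂ (q , r)) = inj₂ (via-trans zs x∈ p q , r)
  via-trans (z ∷ zs) (there x∈) (inj₂ (p , q)) (inj₁ r) = inj₂ (p , via-trans zs x∈ q r)
  via-trans (z ∷ zs) (there x∈) (inj₂ (p , _)) (inj₂ (_ , r)) = inj₂ (p , r)

  walk⇒via : ∀ {u w} → Walk G S u w → Via (allFin (n G)) u w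
  walk⇒via (here s)     = base⇒via _ (s , s , inj₁ refl)
  walk⇒via (step s e p) =
    via-trans _ (∈-allFin _) (base⇒via _ (s , walk-source p , inj₂ e)) (walk⇒via p)

walk? : ∀ G S u w → Dec (Walk G S u w)
walk? G S u w = map′ (via⇒walk _) walk⇒via (via? (allFin (n G)) u w)
  where open Reachability G S

-- Fans

record Fan (m : ℕ) (G : Graph) (v : V G) : Set where
  field
    tip     : Fin m → V G
    tip-inj : Injective _≡_ _≡_ tip
    spoke   : ∀ i → adj G v (tip i) ≡ true
    linked  : ∀ i j → Walk G (avoid {G} v) (tip i) (tip j)
open Fan

-- Equivalently: all blocks of G have maximum degree at most d.
FanFree : ℕ → GraphClass
FanFree d G = ∀ v → ¬ Fan (suc d) G v

-- Finitely many counts decide this: a fan exists iff, for some u, more than d neighbours of v are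
-- reachable from u in G - v. Any tip can serve as u.
fan? : ∀ d G v → Dec (Fan (suc d) G v)
fan? d G v = map′ toFan fromFan (any? λ u → d <? count (near u))
  where
  near : V G → V G → Bool
  near u w = adj G v w ∧ does (walk? G (avoid {G} v) u w)
  toFan : (∃ λ u → d < count (near u)) → Fan (suc d) G v
  toFan (u , d<) with ≤count⇒injection (near u) d<
  ... | f , f-inj , nf = record
    { tip = f ; tip-inj = f-inj ; spoke = λ i → proj₁ (∧-true⁻ (adj G v (f i)) (nf i))
    ; linked = λ i j → reverse-walk (from-u i) ++ʷ from-u j }
    where
    from-u : ∀ i → Walk G (avoid {G} v) u (f i)
    from-u i = does⁻ (walk? G _ u (f i)) (proj₂ (∧-true⁻ (adj G v (f i)) (nf i)))
  fromFan : Fan (suc d) G v → ∃ λ u → d < count (near u)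
  fromFan Φ = tip Φ zero , injection⇒≤count (tip Φ) (tip-inj Φ)
    (λ i → ∧-true (spoke Φ i) (dec-true (walk? G _ _ _) (linked Φ zero i)))

¬FanFree⇒Fan : ∀ d G → ¬ FanFree d G → ∃ λ v → Fan (suc d) G v
¬FanFree⇒Fan d G ¬ff with any? (fan? d G)
... | yes Φ = Φ
... | no ¬Φ = contradiction (λ v Φ → ¬Φ (v , Φ)) ¬ff

-- Cycles and simple paths

next-inject₁ : ∀ {m} (i : Fin m) → next (inject₁ i) ≡ suc i
next-inject₁ {m} i with suc (toℕ (inject₁ i)) <? suc m
... | yes p = toℕ-injective (trans (toℕ-fromℕ< p) (cong suc (toℕ-inject₁ i)))
... | no ¬p = contradiction (s≤s (subst (_< m) (≡-sym (toℕ-inject₁ i)) (toℕ<n i))) ¬p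

next-fromℕ : ∀ m → next (fromℕ m) ≡ zero
next-fromℕ m with suc (toℕ (fromℕ m)) <? suc m
... | yes (s≤s p) = contradiction p (<-irrefl (toℕ-fromℕ m))
... | no _ = refl

prev : ∀ {m} → Fin (suc m) → Fin (suc m)
prev {m} zero = fromℕ m
prev (suc i)  = inject₁ i

next-prev : ∀ {m} (i : Fin (suc m)) → next (prev i) ≡ i
next-prev {m} zero = next-fromℕ m
next-prev (suc i)  = next-inject₁ i

prev-next : ∀ {m} (i : Fin (suc m)) → prev (next i) ≡ i
prev-next {m} i with view i
... | ‵fromℕ = cong prev (next-fromℕ m)
... | ‵inject₁ j = cong prev (next-inject₁ _)

-- Cyclically, i - 1 and i + 1 coincide only for lengths 1 and 2, hence the `3 + m`. It gives every
-- vertex of a cycle two distinct neighbours there.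
prev≢next : ∀ {m} (i : Fin (3 + m)) → prev i ≢ next i
prev≢next zero e with () ← trans e (next-inject₁ zero)
prev≢next (suc i) e with view i
... | ‵fromℕ with () ← trans e (next-fromℕ _)
... | ‵inject₁ j = <-irrefl eq (s≤s (n≤1+n _))
  where
  eq : toℕ j ≡ suc (suc (toℕ j))
  eq = trans (≡-sym (trans (toℕ-inject₁ (inject₁ j)) (toℕ-inject₁ j)))
             (cong toℕ (trans e (next-inject₁ (suc j))))

-- From i climb to the last index, wrap around to `zero`, and climb from there to j.
next-induction : ∀ {m} (P : Fin (suc m) → Set) → (∀ i → P i → P (next i)) → ∀ i → P i → ∀ j → P j
next-induction {m} P stp i pi =
  <-weakInduction P p0 (λ j pj → subst P (next-inject₁ j) (stp _ pj))
  where
  p0 : P zero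
  p0 = subst P (next-fromℕ m) (stp _
    (>-weakInduction (λ j → P j → P (fromℕ m)) id
      (λ j ih pj → ih (subst P (next-inject₁ j) (stp _ pj))) i pi))

data Simple (G : Graph) (S : VSet G) : V G → V G → List (V G) → Set where
  one  : ∀ {u} → S u ≡ true → Simple G S u u (u ∷ [])
  cons : ∀ {u x w xs} → S u ≡ true → adj G u x ≡ true → u ∉ xs → Simple G S x w xs → Simple G S u w (u ∷ xs)

module _ {G : Graph} where
  open import Data.List.Membership.DecPropositional (_≟_ {n G}) using (_∈?_)

  simple-⊆ : ∀ {S S' : VSet G} → (∀ x → S x ≡ true → S' x ≡ true) → ∀ {u w xs} → Simple G S u w xs → Simple G S' u w xs
  simple-⊆ sub (one s)         = one (sub _ s)
  simple-⊆ sub (cons s e u∉ p) = cons (sub _ s) e u∉ (simple-⊆ sub p)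

  simple-∈ : ∀ {S u w xs y} → Simple G S u w xs → y ∈ xs → S y ≡ true
  simple-∈ (one s)         (here refl) = s
  simple-∈ (cons s _ _ _) (here refl) = s
  simple-∈ (cons _ _ _ p) (there y∈)  = simple-∈ p y∈

  simple-suffix : ∀ {S u w xs y} → Simple G S u w xs → y ∈ xs → ∃ λ ys → Simple G S y w ys
  simple-suffix p@(one _)         (here refl) = _ , p
  simple-suffix p@(cons _ _ _ _) (here refl) = _ , p
  simple-suffix (cons _ _ _ p)   (there y∈)  = simple-suffix p y∈

  -- Loop erasure: if u recurs on the remaining path, everything before that occurrence is dropped.
  walk⇒simple : ∀ {S u w} → Walk G S u w → ∃ λ xs → Simple G S u w xs
  walk⇒simple (here s) = _ , one s
  walk⇒simple {u = u} (step s e p) with walk⇒simple p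
  ... | xs , q with u ∈? xs
  ... | yes u∈ = simple-suffix q u∈
  ... | no u∉  = _ , cons s e u∉ q

  simple-lookup-inj : ∀ {S u w xs} → Simple G S u w xs → Injective _≡_ _≡_ (lookup xs)
  simple-lookup-inj (one _)          {zero}  {zero}  _ = refl
  simple-lookup-inj (cons _ _ _ _)  {zero}  {zero}  _ = refl
  simple-lookup-inj (cons _ _ u∉ _) {zero}  {suc j} e = contradiction (subst (_∈ _) (≡-sym e) (∈-lookup j)) u∉
  simple-lookup-inj (cons _ _ u∉ _) {suc i} {zero}  e = contradiction (subst (_∈ _) e (∈-lookup i)) u∉
  simple-lookup-inj (cons _ _ _ p)  {suc i} {suc j} e = cong suc (simple-lookup-inj p e)

  simple-head : ∀ {S u w x xs} → Simple G S u w (x ∷ xs) → x ≡ u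
  simple-head (one _)         = refl
  simple-head (cons _ _ _ _) = refl

  simple-last : ∀ {S u w x xs} → Simple G S u w (x ∷ xs) → lookup (x ∷ xs) (fromℕ (length xs)) ≡ w
  simple-last (one _) = refl
  simple-last (cons _ _ _ p@(one _)) = simple-last p
  simple-last (cons _ _ _ p@(cons _ _ _ _)) = simple-last p

  simple-adj : ∀ {S u w x xs} → Simple G S u w (x ∷ xs) → (i : Fin (length xs)) →
    adj G (lookup (x ∷ xs) (inject₁ i)) (lookup xs i) ≡ true
  simple-adj (cons _ e _ p@(one _)) zero = e
  simple-adj (cons _ e _ p@(cons _ _ _ _)) zero = e
  simple-adj (cons _ _ _ p@(cons _ _ _ _)) (suc i) = simple-adj p i

  close : ∀ {S u w x y z zs} → Simple G S u w (x ∷ y ∷ z ∷ zs) → adj G w u ≡ true → Cycle G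
  close {x = x} {y} {z} {zs} p wu = record { len = length zs ; cv = at ; inj = simple-lookup-inj p ; edge = at-edge }
    where
    at = lookup (x ∷ y ∷ z ∷ zs)
    at-edge : ∀ i → adj G (at i) (at (next i)) ≡ true
    at-edge i with view i
    ... | ‵fromℕ rewrite next-fromℕ (2 + length zs) | simple-last p | simple-head p = wu
    ... | ‵inject₁ j rewrite next-inject₁ j = simple-adj p j

  -- A simple path from a to b in G - v has at least two vertices as a ≢ b, so closing it up through
  -- v gives a cycle of length at least three.
  cycle-through : ∀ {v a b} → adj G v a ≡ true → adj G v b ≡ true → a ≢ b → Walk G (avoid {G} v) a b →
    Σ (Cycle G) λ C → CycleEdge C v a × CycleEdge C v b
  cycle-through {v} {a} {b} va vb a≢b p with walk⇒simple p
  ... | _ , one _ = contradiction refl a≢b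
  ... | _ , q@(cons {xs = []} _ _ _ ())
  ... | _ , q@(cons {xs = x ∷ xs} s e a∉ r) =
    -- v sits at index 0, a at index 1 and b at the last index, so the two cycle edges at v start at
    -- the indices `zero` and `fromℕ _`.
    C , (zero , inj₁ (refl , cong (cv C) (next-inject₁ zero)))
      , (fromℕ _ , inj₂ (simple-last path , cong (cv C) (next-fromℕ _)))
    where
    path : Simple G (everywhere {G}) v b (v ∷ a ∷ x ∷ xs)
    path = cons refl va (λ v∈ → avoid⁻ {c = v} (simple-∈ q v∈) refl) (simple-⊆ (λ _ _ → refl) q)
    C = close path (adj-sym G vb)

acyclic⇒no-link : ∀ {T v a b} → Acyclic T → adj T v a ≡ true → adj T v b ≡ true → Walk T (avoid {T} v) a b → a ≡ b
acyclic⇒no-link {a = a} {b} ac va vb p with a ≟ b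
... | yes e = e
... | no a≢b = contradiction (proj₁ (cycle-through va vb a≢b p)) ac

-- Cactus graphs

module _ {G : Graph} (C : Cycle G) where

  cycleEdge⇒ : ∀ i {b} → CycleEdge C (cv C i) b → b ≡ cv C (next i) ⊎ b ≡ cv C (prev i)
  cycleEdge⇒ i (j , inj₁ (e , refl)) = inj₁ (cong (cv C ∘ next) (inj C e))
  cycleEdge⇒ i (j , inj₂ (refl , e)) =
    inj₂ (cong (cv C) (trans (≡-sym (prev-next j)) (cong prev (inj C e))))

  on-source : ∀ {a b} → CycleEdge C a b → OnCycle C a
  on-source (j , inj₁ (e , _)) = j , e
  on-source (j , inj₂ (_ , e)) = next j , e

  on-target : ∀ {a b} → CycleEdge C a b → OnCycle C b
  on-target (j , inj₁ (_ , e)) = next j , e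
  on-target (j , inj₂ (e , _)) = j , e

  edge-prev : ∀ i → adj G (cv C i) (cv C (prev i)) ≡ true
  edge-prev i = adj-sym G (subst (λ j → adj G (cv C (prev i)) (cv C j) ≡ true) (next-prev i) (edge C (prev i)))

  cycle-walk : ∀ i {y} → OnCycle C y → y ≢ cv C i → Walk G (avoid {G} (cv C i)) (cv C (next i)) y
  cycle-walk i (j , refl) y≢ with next-induction P P-next (next i) (inj₂ (here (avoid⁺ (ni≢i)))) j
    where
    x = cv C i
    P : Fin _ → Set
    P j = cv C j ≡ x ⊎ Walk G (avoid {G} x) (cv C (next i)) (cv C j)
    ni≢i : cv C (next i) ≢ cv C i
    ni≢i e = adj⇒≢ G (edge C i) (≡-sym e)
    P-next : ∀ j → P j → P (next j)
    -- The induction runs around the whole cycle and passes x itself; right after x the walk starts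
    -- afresh.
    P-next j (inj₁ e) = inj₂ (subst (λ k → Walk G (avoid {G} x) (cv C (next i)) (cv C (next k))) (≡-sym (inj C e)) (here (avoid⁺ ni≢i)))
    P-next j (inj₂ p) with cv C (next j) ≟ x
    ... | yes e = inj₁ e
    ... | no ne = inj₂ (p ++ʷ edge-walk (walk-target p) (avoid⁺ ne) (edge C j))
  ... | inj₁ e = contradiction e y≢
  ... | inj₂ p = p

fan₃ : ∀ {G v a b c} → a ≢ b → a ≢ c → b ≢ c → adj G v a ≡ true → adj G v b ≡ true → adj G v c ≡ true →
  Walk G (avoid {G} v) a b → Walk G (avoid {G} v) a c → Fan 3 G v
fan₃ {G} {v} {a} {b} {c} a≢b a≢c b≢c va vb vc ab ac = record
  { tip = t ; tip-inj = t-inj ; spoke = sp ; linked = λ i j → reverse-walk (from-a i) ++ʷ from-a j }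
  where
  t : Fin 3 → V G
  t zero = a
  t (suc zero) = b
  t (suc (suc zero)) = c
  t-inj : Injective _≡_ _≡_ t
  t-inj {zero} {zero} _ = refl
  t-inj {zero} {suc zero} e = contradiction e a≢b
  t-inj {zero} {suc (suc zero)} e = contradiction e a≢c
  t-inj {suc zero} {zero} e = contradiction (≡-sym e) a≢b
  t-inj {suc zero} {suc zero} _ = refl
  t-inj {suc zero} {suc (suc zero)} e = contradiction e b≢c
  t-inj {suc (suc zero)} {zero} e = contradiction (≡-sym e) a≢c
  t-inj {suc (suc zero)} {suc zero} e = contradiction (≡-sym e) b≢c
  t-inj {suc (suc zero)} {suc (suc zero)} _ = refl
  sp : ∀ i → adj G v (t i) ≡ true
  sp zero = va
  sp (suc zero) = vb
  sp (suc (suc zero)) = vc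
  from-a : ∀ i → Walk G (avoid {G} v) a (t i)
  from-a zero = here (walk-source ab)
  from-a (suc zero) = ab
  from-a (suc (suc zero)) = ac

fanFree⇒cactus : ∀ {G} → FanFree 2 G → Cactus G
fanFree⇒cactus {G} ff C₁ C₂ u v u≢v u∈₁ v∈₁ u∈₂ v∈₂ a b =
  edges⊆ C₁ C₂ u∈₁ v∈₁ u∈₂ v∈₂ , edges⊆ C₂ C₁ u∈₂ v∈₂ u∈₁ v∈₁
  where
  -- At a common vertex x both cycles minus x are joined to each other, so the two neighbours
  -- of x on the one are the two neighbours of x on the other.
  module _ (C C' : Cycle G) (u∈ : OnCycle C u) (v∈ : OnCycle C v) (u∈' : OnCycle C' u) (v∈' : OnCycle C' v) where

    -- Two distinct common vertices are given so that, whichever x is removed, one of them remains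
    -- to join the two cycles.
    other : ∀ x → ∃ λ y → y ≢ x × OnCycle C y × OnCycle C' y
    other x with u ≟ x
    ... | no u≢x = u , u≢x , u∈ , u∈'
    ... | yes refl = v , ≢-sym u≢v , v∈ , v∈'

    edge-shared : ∀ i → OnCycle C' (cv C i) → CycleEdge C' (cv C i) (cv C (next i))
    edge-shared i (j , e) with cv C (next i) ≟ cv C' (next j) | cv C (next i) ≟ cv C' (prev j)
    ... | yes p | _ = j , inj₁ (e , ≡-sym p)
    ... | no _  | yes q = prev j , inj₂ (≡-sym q , trans (cong (cv C') (next-prev j)) e)
    ... | no ¬p | no ¬q = ⊥-elim (ff (cv C i) (fan₃ ¬p ¬q p≢q (edge C i) n' q' (to-C' n∈ n≢) (to-C' p∈ p≢)))
      where
      x = cv C i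
      n∈ : OnCycle C' (cv C' (next j))
      n∈ = next j , refl
      p∈ : OnCycle C' (cv C' (prev j))
      p∈ = prev j , refl
      n' : adj G x (cv C' (next j)) ≡ true
      n' = subst (λ z → adj G z (cv C' (next j)) ≡ true) e (edge C' j)
      q' : adj G x (cv C' (prev j)) ≡ true
      q' = subst (λ z → adj G z (cv C' (prev j)) ≡ true) e (edge-prev C' j)
      n≢ : cv C' (next j) ≢ x
      n≢ = ≢-sym (adj⇒≢ G n')
      p≢ : cv C' (prev j) ≢ x
      p≢ = ≢-sym (adj⇒≢ G q')
      p≢q : cv C' (next j) ≢ cv C' (prev j)
      p≢q eq = prev≢next j (≡-sym (inj C' eq))
      to-C' : ∀ {y} → OnCycle C' y → y ≢ x → Walk G (avoid {G} x) (cv C (next i)) y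
      to-C' y∈ y≢ with other x
      ... | z , z≢ , z∈ , z∈' = cycle-walk C i z∈ z≢ ++ʷ reverse-walk (walk' z∈' z≢) ++ʷ walk' y∈ y≢
        where
        walk' : ∀ {y} → OnCycle C' y → y ≢ x → Walk G (avoid {G} x) (cv C' (next j)) y
        walk' {y} y∈ y≢ = subst (λ c → Walk G (avoid {G} c) (cv C' (next j)) y) e
          (cycle-walk C' j y∈ (λ eq → y≢ (trans eq e)))

    -- Starting at u, C never leaves C': an edge of C at a common vertex is an edge of C', so its
    -- other end is common as well.
    shared : ∀ i → OnCycle C' (cv C i)
    shared = next-induction (λ i → OnCycle C' (cv C i)) (λ i p → on-target C' (edge-shared i p)) (proj₁ u∈)
      (subst (OnCycle C') (≡-sym (proj₂ u∈)) u∈')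

    edges⊆ : ∀ {a b} → CycleEdge C a b → CycleEdge C' a b
    edges⊆ (i , inj₁ (refl , refl)) = edge-shared i (shared i)
    edges⊆ (i , inj₂ (refl , refl)) with edge-shared i (shared i)
    ... | j , inj₁ e = j , inj₂ e
    ... | j , inj₂ e = j , inj₁ e

-- A cycle through w₀, v, w₁ and one through w₂, v, w₁ share v and w₁, so they have the same edges.
-- Then v would have three neighbours on one cycle.
cactus⇒fanFree : ∀ {G} → Cactus G → FanFree 2 G
cactus⇒fanFree {G} cactus v Φ with cycle-through (spoke Φ zero) (spoke Φ (suc zero)) (ne λ ()) (linked Φ zero (suc zero))
                    | cycle-through (spoke Φ (suc (suc zero))) (spoke Φ (suc zero)) (ne λ ()) (linked Φ (suc (suc zero)) (suc zero))
  where
  ne : ∀ {i j} → i ≢ j → tip Φ i ≢ tip Φ j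
  ne i≢j e = i≢j (tip-inj Φ e)
... | C , e₀ , e₁ | C' , e₂ , e₁' =
  two-neighbours (on-source C e₀) e₀ e₁ (proj₂ (cactus C C' v (tip Φ (suc zero)) (adj⇒≢ G (spoke Φ (suc zero)))
    (on-source C e₀) (on-target C e₁) (on-source C' e₂) (on-target C' e₁') v (tip Φ (suc (suc zero)))) e₂)
  where
  diff : ∀ {i j x} → i ≢ j → tip Φ i ≡ x → tip Φ j ≡ x → ⊥
  diff i≢j e e' = i≢j (tip-inj Φ (trans e (≡-sym e')))
  two-neighbours : OnCycle C v → CycleEdge C v (tip Φ zero) → CycleEdge C v (tip Φ (suc zero)) →
    CycleEdge C v (tip Φ (suc (suc zero))) → ⊥
  two-neighbours (i , refl) p q r with cycleEdge⇒ C i p | cycleEdge⇒ C i q | cycleEdge⇒ C i r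
  ... | inj₁ x | inj₁ y | _ = diff (λ ()) x y
  ... | inj₂ x | inj₂ y | _ = diff (λ ()) x y
  ... | inj₁ x | inj₂ y | inj₁ z = diff (λ ()) x z
  ... | inj₁ x | inj₂ y | inj₂ z = diff (λ ()) y z
  ... | inj₂ x | inj₁ y | inj₁ z = diff (λ ()) y z
  ... | inj₂ x | inj₁ y | inj₂ z = diff (λ ()) x z

-- 1-sums

-- Cuts a walk after its last visit to s, if there is one. `Star` is used because these walks are
-- restricted by a relation on edges, whereas `Walk` restricts vertices.
last-exit : ∀ {T : Graph} {R : V T → V T → Set} → (∀ {x y} → R x y → adj T x y ≡ true) →
  ∀ {s u w} → w ≢ s → Star R u w →
  Walk T (avoid {T} s) u w ⊎ ∃ λ x → R s x × Walk T (avoid {T} s) x w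
last-exit R⊆ w≢s ε = inj₁ (here (avoid⁺ w≢s))
last-exit R⊆ {s} {u} w≢s (r ◅ p) with last-exit R⊆ w≢s p
... | inj₂ q = inj₂ q
... | inj₁ q with u ≟ s
...   | yes refl = inj₂ (_ , r , q)
...   | no u≢s   = inj₁ (step (avoid⁺ u≢s) (R⊆ r) q)

last-exit-from : ∀ {T : Graph} {R : V T → V T → Set} → (∀ {x y} → R x y → adj T x y ≡ true) →
  ∀ {s w} → w ≢ s → Star R s w → ∃ λ x → R s x × Walk T (avoid {T} s) x w
last-exit-from R⊆ {s} w≢s p with last-exit R⊆ w≢s p
... | inj₁ q = contradiction refl (avoid⁻ {c = s} (walk-source q))
... | inj₂ q = q

-- After their last visits to s the two walks reach w within T - s, so the neighbours x and x' by
-- which they leave s are linked there. Acyclicity forces x = x', and the edge s x belongs to both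
-- relations.
acyclic-edge-disjoint : ∀ {T : Graph} → Acyclic T → {R R' : V T → V T → Set} →
  (∀ {x y} → R x y → adj T x y ≡ true) → (∀ {x y} → R' x y → adj T x y ≡ true) →
  (∀ {x y} → R x y → ¬ R' x y) →
  ∀ {s w} → Star R s w → Star R' s w → s ≡ w
acyclic-edge-disjoint ac R⊆ R'⊆ disj {s} {w} p p' with w ≟ s
... | yes e = ≡-sym e
... | no w≢s with last-exit-from R⊆ w≢s p | last-exit-from R'⊆ w≢s p'
... | x , r , q | x' , r' , q' with acyclic⇒no-link ac (R⊆ r) (R'⊆ r') (q ++ʷ reverse-walk q')
... | refl = ⊥-elim (disj r r')

-- A walk of G − v lifts to a walk in the decomposition tree without edges inside the
-- subtree T_v of bags containing v, since adjacent bags of T_v share nothing but v.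
-- As T is acyclic, all tips of a fan at v thus lie in the same bag of T_v.
oneSums⇒fanFree : ∀ {d G} → OneSums (MaxDegLe d) G → FanFree d G
oneSums⇒fanFree {d} {G} (D , adhesion , torso) v Φ = bound (torso t₀)
  where
  open TreeDecomposition D using () renaming (T to Tr; β to bag)
  home : ∀ i → ∃ λ t → bag t v ≡ true × bag t (tip Φ i) ≡ true
  home i = coverE D v (tip Φ i) (spoke Φ i)
  t₀ = proj₁ (home zero)

  Within Across : V Tr → V Tr → Set
  Within s t = adj Tr s t ≡ true × bag s v ≡ true × bag t v ≡ true
  Across s t = adj Tr s t ≡ true × ¬ (bag s v ≡ true × bag t v ≡ true)

  within : ∀ {s t} → Walk Tr (λ r → bag r v) s t → Star Within s t
  within (here _)     = ε
  within (step s e p) = (e , s , walk-source p) ◅ within p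

  two-shared : ∀ {s t u} → u ≢ v → adj Tr s t ≡ true → bag s u ≡ true → bag t u ≡ true →
    ¬ (bag s v ≡ true × bag t v ≡ true)
  two-shared {s} {t} {u} u≢v st su tu (sv , tv) =
    <⇒≱ (injection⇒≤count f f-inj f-shared) (adhesion s t st)
    where
    f : Fin 2 → V G
    f zero    = u
    f (suc _) = v
    f-inj : Injective _≡_ _≡_ f
    f-inj {zero}     {zero}     _ = refl
    f-inj {zero}     {suc zero} e = contradiction e u≢v
    f-inj {suc zero} {zero}     e = contradiction (≡-sym e) u≢v
    f-inj {suc zero} {suc zero} _ = refl
    f-shared : ∀ i → bag s (f i) ∧ bag t (f i) ≡ true
    f-shared zero    = ∧-true su tu
    f-shared (suc _) = ∧-true sv tv

  across-bags : ∀ {u} → u ≢ v → ∀ {s t} → Walk Tr (λ r → bag r u) s t → Star Across s t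
  across-bags u≢v (here _)     = ε
  across-bags u≢v (step s e p) = (e , two-shared u≢v e s (walk-source p)) ◅ across-bags u≢v p

  across : ∀ {u w} → Walk G (avoid {G} v) u w → ∀ {s t} → bag s u ≡ true → bag t w ≡ true → Star Across s t
  across {u} (here u≢) su tu = across-bags (avoid⁻ u≢) (connV D u _ _ su tu)
  across {u} (step u≢ uw p) su tw with coverE D _ _ uw
  ... | r , ru , rw = across-bags (avoid⁻ u≢) (connV D u _ _ su ru) ◅◅ across p rw tw

  same-bag : ∀ i → bag t₀ (tip Φ i) ≡ true
  same-bag i = subst (λ t → bag t (tip Φ i) ≡ true) (≡-sym t₀≡) (proj₂ (proj₂ (home i)))
    where
    t₀≡ : t₀ ≡ proj₁ (home i)
    t₀≡ = acyclic-edge-disjoint (proj₂ (proj₂ (tree D))) proj₁ proj₁ (λ a w → proj₂ a (proj₂ w))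
      (across (linked Φ zero i) (proj₂ (proj₂ (home zero))) (proj₂ (proj₂ (home i))))
      (within (connV D v _ _ (proj₁ (proj₂ (home zero))) (proj₁ (proj₂ (home i)))))

  bound : ¬ TorsoIn (MaxDegLe d) G (bag t₀)
  bound (H , (e , e-inj , e-surj , e-in , e-adj) , deg≤) =
    <⇒≱ (injection⇒≤count g g-inj g-adj) (deg≤ c)
    where
    v∈ = e-surj v (proj₁ (proj₂ (home zero)))
    c = proj₁ v∈
    g∈ : ∀ i → ∃ λ j → e j ≡ tip Φ i
    g∈ i = e-surj (tip Φ i) (same-bag i)
    g : Fin (suc d) → V H
    g i = proj₁ (g∈ i)
    g-inj : Injective _≡_ _≡_ g
    g-inj {i} {j} eq = tip-inj Φ (trans (≡-sym (proj₂ (g∈ i))) (trans (cong e eq) (proj₂ (g∈ j))))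
    g-adj : ∀ i → adj H c (g i) ≡ true
    g-adj i = proj₂ (e-adj c (g i)) (e-in c , e-in (g i) , adj⇒≢ G edge' , inj₁ edge')
      where
      edge' : adj G (e c) (e (g i)) ≡ true
      edge' = trans (cong₂ (adj G) (proj₂ v∈) (proj₂ (g∈ i))) (spoke Φ i)

-- Attaching leaves to trees

leafAdj : (T : Graph) → V T → Fin (suc (n T)) → Fin (suc (n T)) → Bool
leafAdj T p zero    zero    = false
leafAdj T p zero    (suc j) = eqF p j
leafAdj T p (suc i) zero    = eqF p i
leafAdj T p (suc i) (suc j) = adj T i j

addLeaf : (T : Graph) → V T → Graph
addLeaf T p = record { n = suc (n T) ; adj = leafAdj T p ; sym = symm ; loopless = irr }
  where
  symm : ∀ a b → leafAdj T p a b ≡ leafAdj T p b a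
  symm zero    zero    = refl
  symm zero    (suc _) = refl
  symm (suc _) zero    = refl
  symm (suc i) (suc j) = Graph.sym T i j
  irr : ∀ a → leafAdj T p a a ≡ false
  irr zero    = refl
  irr (suc i) = loopless T i

module _ {T : Graph} {p : V T} where

  leaf-walk : ∀ {S : VSet T} {S' : VSet (addLeaf T p)} → (∀ t → S t ≡ true → S' (suc t) ≡ true) →
    ∀ {u w} → Walk T S u w → Walk (addLeaf T p) S' (suc u) (suc w)
  leaf-walk sub (here s)     = here (sub _ s)
  leaf-walk sub (step s e q) = step (sub _ s) e (leaf-walk sub q)

  -- Meant for the set of nodes whose bags contain a fixed vertex: the second hypothesis says that a
  -- vertex shared by the leaf and some old bag is also in the bag of p.
  leaf-connected : ∀ (S' : VSet (addLeaf T p)) → ConnectedOn T (S' ∘ suc) →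
    (∀ t → S' zero ≡ true → S' (suc t) ≡ true → S' (suc p) ≡ true) → ConnectedOn (addLeaf T p) S'
  leaf-connected S' conn par zero    zero    s₀ _ = here s₀
  leaf-connected S' conn par zero    (suc w) s₀ s =
    step s₀ (eqF-refl p) (leaf-walk (λ _ → id) (conn p w (par w s₀ s) s))
  leaf-connected S' conn par (suc u) zero    s s₀ =
    reverse-walk (leaf-connected S' conn par zero (suc u) s₀ s)
  leaf-connected S' conn par (suc u) (suc w) s s' = leaf-walk (λ _ → id) (conn u w s s')

  leaf-nbr : ∀ {x} → adj (addLeaf T p) zero x ≡ true → x ≡ suc p
  leaf-nbr {suc j} e = cong suc (≡-sym (eqF⇒≡ p j e))

  -- On a cycle through the leaf both cyclic neighbours of the leaf would be p. A cycle missing the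
  -- leaf lies in T.
  leaf-acyclic : Acyclic T → Acyclic (addLeaf T p)
  leaf-acyclic ac C with any? (λ i → cv C i ≟ zero)
  ... | yes (i , e) = prev≢next i (inj C (trans (nbr (edge-prev C i)) (≡-sym (nbr (edge C i)))))
    where
    nbr : ∀ {x} → adj (addLeaf T p) (cv C i) x ≡ true → x ≡ suc p
    nbr {x} a = leaf-nbr (subst (λ c → adj (addLeaf T p) c x ≡ true) e a)
  ... | no ∌0 = ac (record
    { len = len C ; cv = cv' ; inj = λ {i} {j} e → inj C (trans (cv≡ i) (trans (cong suc e) (≡-sym (cv≡ j))))
    ; edge = λ i → subst (_≡ true) (cong₂ (leafAdj T p) (cv≡ i) (cv≡ (next i))) (edge C i) })
    where
    pred : ∀ (x : Fin (suc (n T))) → x ≢ zero → ∃ λ y → x ≡ suc y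
    pred zero    x≢ = contradiction refl x≢
    pred (suc y) _  = y , refl
    old : ∀ i → ∃ λ y → cv C i ≡ suc y
    old i = pred (cv C i) (λ e → ∌0 (i , e))
    cv' = λ i → proj₁ (old i)
    cv≡ = λ i → proj₂ (old i)

  leaf-tree : IsTree T → IsTree (addLeaf T p)
  leaf-tree (_ , conn , ac) = s≤s z≤n , leaf-connected _ conn (λ _ _ _ → refl) , leaf-acyclic ac

-- A bag which is its own torso, of maximum degree at most d.
record SparseBag (d : ℕ) (G : Graph) (B : VSet G) : Set where
  field
    attached : ∀ C → IsComponentOf G B C → ∀ {x y} → B x ≡ true → B y ≡ true →
               InNbhd G C x → InNbhd G C y → x ≡ y
    sparse   : ∀ x → B x ≡ true → count (λ y → B y ∧ adj G x y) ≤ d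

sparseBag⇒torso : ∀ {d G B} → SparseBag d G B → TorsoIn (MaxDegLe d) G B
sparseBag⇒torso {d} {G} {B} sb = H , (elem E , elem-inj E , elem-index E , elem-true E , λ i j → to i j , from i j) , deg
  where
  E = enumerate B
  H : Graph
  H = record { n = count B ; adj = λ i j → adj G (elem E i) (elem E j)
             ; sym = λ i j → Graph.sym G _ _ ; loopless = λ i → loopless G _ }
  to : ∀ i j → adj H i j ≡ true → TorsoAdj G B (elem E i) (elem E j)
  to i j e = elem-true E i , elem-true E j , adj⇒≢ G e , inj₁ e
  from : ∀ i j → TorsoAdj G B (elem E i) (elem E j) → adj H i j ≡ true
  from i j (_ , _ , _ , inj₁ e) = e
  from i j (bi , bj , i≢j , inj₂ (C , comp , ni , nj)) =
    contradiction (SparseBag.attached sb C comp bi bj ni nj) i≢j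
  deg : MaxDegLe d H
  deg i = ≤-trans
    (injection⇒≤count (elem E ∘ elem N) (elem-inj N ∘ elem-inj E) (λ j → ∧-true (elem-true E (elem N j)) (elem-true N j)))
    (SparseBag.sparse sb (elem E i) (elem-true E i))
    where N = enumerate (adj H i)

-- Growing the block decomposition

module Blocks (G : Graph) where

  infix 4 _~_ _~[_]_ _≈_

  _~_ : V G → V G → Set
  x ~ y = Walk G (everywhere {G}) x y

  _~[_]_ : V G → V G → V G → Set
  x ~[ c ] y = Walk G (avoid {G} c) x y

  -- x and y are not separated by a vertex; the blocks are the maximal cliques of this relation.
  -- The conjunct x ~ y only matters if G has no third vertex.
  _≈_ : V G → V G → Set
  x ≈ y = x ~ y × (∀ c → x ≢ c → y ≢ c → x ~[ c ] y)

  ≈? : ∀ x y → Dec (x ≈ y)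
  ≈? x y = walk? G _ x y ×-dec
    all? λ c → ¬? (x ≟ c) →-dec (¬? (y ≟ c) →-dec walk? G _ x y)

  ≈-refl : ∀ {x} → x ≈ x
  ≈-refl = here refl , λ c x≢c _ → here (avoid⁺ x≢c)

  ≈-sym : ∀ {x y} → x ≈ y → y ≈ x
  ≈-sym (p , q) = reverse-walk p , λ c y≢ x≢ → reverse-walk (q c x≢ y≢)

  adj⇒≈ : ∀ {x y} → adj G x y ≡ true → x ≈ y
  adj⇒≈ xy = edge-walk refl refl xy , λ c x≢ y≢ → edge-walk (avoid⁺ x≢) (avoid⁺ y≢) xy

  -- The relation is not transitive, as the middle vertex may be a cut vertex. With two distinct
  -- middle vertices, any removed c leaves one of them usable.
  ≈-through : ∀ {a b z w} → a ≢ b → z ≈ a → z ≈ b → a ≈ w → b ≈ w → z ≈ w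
  ≈-through {a} {b} {z} {w} a≢b (z~a , za) (_ , zb) (a~w , aw) (_ , bw) = z~a ++ʷ a~w , sep
    where
    sep : ∀ c → z ≢ c → w ≢ c → z ~[ c ] w
    sep c z≢ w≢ with a ≟ c
    ... | no a≢    = za c z≢ a≢ ++ʷ aw c a≢ w≢
    ... | yes refl = zb c z≢ (≢-sym a≢b) ++ʷ bw c (≢-sym a≢b) w≢

  -- Two distinct vertices lie in at most one common block, so p and q serve as coordinates for it.
  block : V G → V G → VSet G
  block p q z = does (≈? z p) ∧ does (≈? z q)

  block⁺ : ∀ {p q z} → z ≈ p → z ≈ q → block p q z ≡ true
  block⁺ zp zq = ∧-true (dec-true (≈? _ _) zp) (dec-true (≈? _ _) zq)

  block⁻ : ∀ {p q z} → block p q z ≡ true → z ≈ p × z ≈ q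
  block⁻ {p} {q} {z} e with ∧-true⁻ (does (≈? z p)) e
  ... | ep , eq = does⁻ (≈? z p) ep , does⁻ (≈? z q) eq

  block-clique : ∀ {p q x y} → p ≢ q → block p q x ≡ true → block p q y ≡ true → x ≈ y
  block-clique p≢q bx by with block⁻ bx | block⁻ by
  ... | xp , xq | yp , yq = ≈-through p≢q xp xq (≈-sym yp) (≈-sym yq)

  block-maximal : ∀ {p q x y z} → x ≢ y → block p q x ≡ true → block p q y ≡ true → z ≈ x → z ≈ y → block p q z ≡ true
  block-maximal x≢y bx by zx zy with block⁻ bx | block⁻ by
  ... | xp , xq | yp , yq = block⁺ (≈-through x≢y zx zy xp yp) (≈-through x≢y zx zy xq yq)

  -- If a component C attached at x ≠ y, its vertex c adjacent to x would belong to the block: a cut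
  -- vertex inside C leaves the way over x, as x ≈ y, and one outside C leaves the way through C to
  -- y. More than d neighbours of x in the block are linked in G - x, hence form a fan at x.
  block-sparse : ∀ {d p q} → FanFree d G → p ≢ q → SparseBag d G (block p q)
  block-sparse {d} {p} {q} ff p≢q = record { attached = att ; sparse = spa }
    where
    B = block p q
    att : ∀ C → IsComponentOf G B C → ∀ {x y} → B x ≡ true → B y ≡ true → InNbhd G C x → InNbhd G C y → x ≡ y
    att C (C∩B , _ , C-conn , _) {x} {y} bx by (¬Cx , c , Cc , cx) (¬Cy , c' , Cc' , c'y) with x ≟ y
    ... | yes e = e
    ... | no x≢y = ⊥-elim (true≢false (block-maximal x≢y bx by (adj⇒≈ cx) c≈y) (C∩B c Cc))
      where
      xy = block-clique p≢q bx by
      outside : ∀ {s z} → C s ≡ false → C z ≡ true → z ≢ s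
      outside ¬Cs Cz refl = true≢false Cz ¬Cs
      c≈y : c ≈ y
      c≈y = edge-walk refl refl cx ++ʷ proj₁ xy , sep
        where
        sep : ∀ s → c ≢ s → y ≢ s → c ~[ s ] y
        sep s c≢ y≢ with C s in Cs
        ... | true  = edge-walk (avoid⁺ c≢) (avoid⁺ x≢) cx ++ʷ proj₂ xy s x≢ y≢
          where x≢ = ≢-sym (outside ¬Cx Cs)
        ... | false = walk-⊆ (λ z Cz → avoid⁺ (outside Cs Cz)) (C-conn c c' Cc Cc')
                      ++ʷ edge-walk (avoid⁺ (outside Cs Cc')) (avoid⁺ y≢) c'y
    spa : ∀ x → B x ≡ true → count (λ y → B y ∧ adj G x y) ≤ d
    spa x bx with d <? count (λ y → B y ∧ adj G x y)
    ... | no d≮ = ≮⇒≥ d≮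
    ... | yes d< with ≤count⇒injection _ d<
    ... | f , f-inj , f-nbr = ⊥-elim (ff x (record
      { tip = f ; tip-inj = f-inj ; spoke = spk
      ; linked = λ i j → proj₂ (block-clique p≢q (inB i) (inB j)) x (≢-sym (adj⇒≢ G (spk i))) (≢-sym (adj⇒≢ G (spk j))) }))
      where
      inB : ∀ i → B (f i) ≡ true
      inB i = proj₁ (∧-true⁻ (B (f i)) (f-nbr i))
      spk : ∀ i → adj G x (f i) ≡ true
      spk i = proj₂ (∧-true⁻ (B (f i)) (f-nbr i))

  -- A decomposition of the vertex set X, complete for the blocks meeting X in an edge of ≈,
  -- such that no outside vertex separates vertices of X.
  record Partial (d : ℕ) : Set where
    field
      X         : VSet G
      Tr        : Graph
      isTree    : IsTree Tr
      bag       : V Tr → VSet G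
      bag⊆X     : ∀ t v → bag t v ≡ true → X v ≡ true
      X⊆bag     : ∀ v → X v ≡ true → ∃ λ t → bag t v ≡ true
      conn      : ∀ v → ConnectedOn Tr (λ t → bag t v)
      adhesion  : ∀ t t' → adj Tr t t' ≡ true → count (λ v → bag t v ∧ bag t' v) ≤ 1
      bagSparse : ∀ t → SparseBag d G (bag t)
      blocks    : ∀ x y → X x ≡ true → X y ≡ true → x ≢ y → x ≈ y →
                  ∃ λ t → ∀ z → z ≈ x → z ≈ y → bag t z ≡ true
      convex    : ∀ x y → X x ≡ true → X y ≡ true → x ~ y → ∀ c → X c ≡ false → x ~[ c ] y
  open Partial

  -- A tree has at least one node, so the construction starts from a node with an empty bag.
  emptyPartial : ∀ {d} → Partial d
  emptyPartial = record
    { X = λ _ → false ; Tr = K₁ ; isTree = s≤s z≤n , (λ { zero zero _ _ → here refl }) , acyclic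
    ; bag = λ _ _ → false ; bag⊆X = λ _ _ e → e ; X⊆bag = λ _ () ; conn = λ { _ zero zero s _ → here s }
    ; adhesion = λ _ _ () ; bagSparse = λ _ → record { attached = λ _ _ () ; sparse = λ _ () }
    ; blocks = λ _ _ () ; convex = λ _ _ () }
    where
    K₁ : Graph
    K₁ = record { n = 1 ; adj = λ _ _ → false ; sym = λ _ _ → refl ; loopless = λ _ → refl }
    acyclic : Acyclic K₁
    acyclic C with () ← edge C zero

  ∨-true⁻ : ∀ a {b} → a ∨ b ≡ true → a ≡ true ⊎ b ≡ true
  ∨-true⁻ true  _ = inj₁ refl
  ∨-true⁻ false e = inj₂ e

  ∨-false⁻ : ∀ a {b} → a ∨ b ≡ false → a ≡ false × b ≡ false
  ∨-false⁻ false e = refl , e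

  module _ {d : ℕ} (P : Partial d) where

    -- The step common to both extensions below: B becomes the bag of a new leaf at p. Since B meets
    -- X in at most one vertex, lying in the bag of p, adhesion and connectedness survive. By
    -- `no-cross`, no pair of `blocks` joins X - B to B - X.
    module _ (B : VSet G) (p : V (Tr P)) (B-sparse : SparseBag d G B)
      (B∩X⊆p : ∀ z → B z ≡ true → X P z ≡ true → bag P p z ≡ true)
      (B∩X≤1 : ∀ y z → B y ≡ true → X P y ≡ true → B z ≡ true → X P z ≡ true → y ≡ z)
      (no-cross : ∀ x y → X P x ≡ true → B x ≡ false → B y ≡ true → X P y ≡ false → ¬ x ≈ y)
      (B-block : ∀ x y → B x ≡ true → B y ≡ true → x ≢ y → x ≈ y → ∀ z → z ≈ x → z ≈ y → B z ≡ true)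
      (convex' : ∀ x y → X P x ∨ B x ≡ true → X P y ∨ B y ≡ true → x ~ y →
                 ∀ c → X P c ∨ B c ≡ false → x ~[ c ] y)
      {q : V G} (Xq : X P q ≡ false) (Bq : B q ≡ true)
      where

      private
        X' : VSet G
        X' v = X P v ∨ B v

        T' = addLeaf (Tr P) p

        bag' : V T' → VSet G
        bag' zero    = B
        bag' (suc t) = bag P t

        ∨-left : ∀ {a b} → a ≡ true → a ∨ b ≡ true
        ∨-left refl = refl

        ∨-right : ∀ a {b} → b ≡ true → a ∨ b ≡ true
        ∨-right true  _ = refl
        ∨-right false e = e

        X'⊆bag : ∀ v → X' v ≡ true → ∃ λ t → bag' t v ≡ true
        X'⊆bag v e with X P v in Xv
        ... | true  = suc (proj₁ (X⊆bag P v Xv)) , proj₂ (X⊆bag P v Xv)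
        ... | false = zero , e

        adhesion' : ∀ t t' → adj T' t t' ≡ true → count (λ v → bag' t v ∧ bag' t' v) ≤ 1
        adhesion' zero (suc t) _ = count≤1 _ λ y z ey ez →
          let by , ty = ∧-true⁻ (B y) ey ; bz , tz = ∧-true⁻ (B z) ez
          in B∩X≤1 y z by (bag⊆X P t y ty) bz (bag⊆X P t z tz)
        adhesion' (suc t) zero _ = count≤1 _ λ y z ey ez →
          let ty , by = ∧-true⁻ (bag P t y) ey ; tz , bz = ∧-true⁻ (bag P t z) ez
          in B∩X≤1 y z by (bag⊆X P t y ty) bz (bag⊆X P t z tz)
        adhesion' (suc t) (suc t') e = adhesion P t t' e

        blocks' : ∀ x y → X' x ≡ true → X' y ≡ true → x ≢ y → x ≈ y →
                  ∃ λ t → ∀ z → z ≈ x → z ≈ y → bag' t z ≡ true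
        blocks' x y ex ey x≢y x≈y with X P x in Xx | X P y in Xy | B x in Bx | B y in By
        ... | true | true | _ | _ = let t , h = blocks P x y Xx Xy x≢y x≈y in suc t , h
        ... | _ | _ | true | true = zero , B-block x y Bx By x≢y x≈y
        ... | true | false | false | true = ⊥-elim (no-cross x y Xx Bx By Xy x≈y)
        ... | false | true | true | false = ⊥-elim (no-cross y x Xy By Bx Xx (≈-sym x≈y))

        P' : Partial d
        P' = record
          { X = X' ; Tr = T' ; isTree = leaf-tree (isTree P) ; bag = bag'
          ; bag⊆X = λ { zero v e → ∨-right (X P v) e ; (suc t) v e → ∨-left (bag⊆X P t v e) }
          ; X⊆bag = X'⊆bag
          ; conn = λ v → leaf-connected (λ t → bag' t v) (conn P v) (λ t b e → B∩X⊆p v b (bag⊆X P t v e))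
          ; adhesion = adhesion'
          ; bagSparse = λ { zero → B-sparse ; (suc t) → bagSparse P t }
          ; blocks = blocks' ; convex = convex' }

        shrink : ∀ a {b} → not (a ∨ b) ≡ true → not a ≡ true
        shrink false _ = refl

      extend : Σ (Partial d) λ P' → count (not ∘ X P') < count (not ∘ X P)
      extend = P' , count-strict _ _ (λ v → shrink (X P v)) q (cong not Xq) (cong not (∨-right (X P q) Bq))

    -- The block of an edge pq leaving X meets X only in p. A pair x ≈ y with x in X and y in
    -- that block would force x ≈ p, by convexity of X, and so put x into the block as well.
    module _ (ff : FanFree d G) {p q : V G} (Xp : X P p ≡ true) (Xq : X P q ≡ false) (pq : adj G p q ≡ true) where
      private
        B = block p q
        p≢q = adj⇒≢ G pq
        p≈q = adj⇒≈ pq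
        Bp : B p ≡ true
        Bp = block⁺ ≈-refl p≈q
        Bq : B q ≡ true
        Bq = block⁺ (≈-sym p≈q) ≈-refl

        -- A second common vertex z would be a partner of p within X, and `blocks` would put their
        -- whole block, including q, into an old bag.
        only-p : ∀ z → B z ≡ true → X P z ≡ true → p ≡ z
        only-p z bz xz with p ≟ z
        ... | yes e = e
        ... | no p≢z with blocks P p z Xp xz p≢z (block-clique p≢q Bp bz)
        ... | t , h = ⊥-elim (true≢false (bag⊆X P t q (h q (≈-sym p≈q) (block-clique p≢q Bq bz))) Xq)

        no-cross : ∀ x y → X P x ≡ true → B x ≡ false → B y ≡ true → X P y ≡ false → ¬ x ≈ y
        no-cross x y xx ¬bx by ¬xy x≈y@(x~y , sxy) = true≢false (block-maximal y≢p by Bp x≈y (x~p , sep)) ¬bx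
          where
          y≢p : y ≢ p
          y≢p refl = true≢false Xp ¬xy
          y≈p = block-clique p≢q by Bp
          x~p : x ~ p
          x~p = x~y ++ʷ proj₁ y≈p
          sep : ∀ c → x ≢ c → p ≢ c → x ~[ c ] p
          sep c x≢ p≢ with X P c in xc
          ... | false = convex P x p xx Xp x~p c xc
          ... | true  = sxy c x≢ y≢ ++ʷ proj₂ y≈p c y≢ p≢
            where
            y≢ : y ≢ c
            y≢ refl = true≢false xc ¬xy

        convex' : ∀ x y → X P x ∨ B x ≡ true → X P y ∨ B y ≡ true → x ~ y →
                  ∀ c → X P c ∨ B c ≡ false → x ~[ c ] y
        convex' x y ex ey x~y c ec = go (∨-true⁻ (X P x) ex) (∨-true⁻ (X P y) ey)
          where
          ¬Xc = proj₁ (∨-false⁻ (X P c) ec)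
          ¬Bc = proj₂ (∨-false⁻ (X P c) ec)
          inB : ∀ {z w} → B z ≡ true → B w ≡ true → z ~[ c ] w
          inB bz bw = proj₂ (block-clique p≢q bz bw) c (≢-by bz) (≢-by bw)
            where
            ≢-by : ∀ {z} → B z ≡ true → z ≢ c
            ≢-by bz refl = true≢false bz ¬Bc
          via-p : ∀ {z w} → X P z ≡ true → B w ≡ true → z ~ w → z ~[ c ] w
          via-p xz bw z~w = convex P _ p xz Xp (z~w ++ʷ proj₁ (block-clique p≢q bw Bp)) c ¬Xc ++ʷ inB Bp bw
          go : X P x ≡ true ⊎ B x ≡ true → X P y ≡ true ⊎ B y ≡ true → x ~[ c ] y
          go (inj₁ xx) (inj₁ xy) = convex P x y xx xy x~y c ¬Xc
          go (inj₁ xx) (inj₂ by) = via-p xx by x~y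
          go (inj₂ bx) (inj₁ xy) = reverse-walk (via-p xy bx (reverse-walk x~y))
          go (inj₂ bx) (inj₂ by) = inB bx by

        B∩X⊆ : ∀ z → B z ≡ true → X P z ≡ true → bag P (proj₁ (X⊆bag P p Xp)) z ≡ true
        B∩X⊆ z bz xz = subst (λ u → bag P _ u ≡ true) (only-p z bz xz) (proj₂ (X⊆bag P p Xp))

      extendByBlock : Σ (Partial d) λ P' → count (not ∘ X P') < count (not ∘ X P)
      extendByBlock = extend _ _ (block-sparse ff p≢q) B∩X⊆ B∩X≤1 no-cross B-block convex' Xq Bq
        where
        B∩X≤1 = λ y z by xy bz xz → trans (≡-sym (only-p y by xy)) (only-p z bz xz)
        B-block = λ x y bx by x≢y _ z zx zy → block-maximal x≢y bx by zx zy

    -- Here X is a union of components, so the bag consisting of q alone shares nothing with the old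
    -- bags and may hang from any node.
    module _ (closed : ∀ p q → X P p ≡ true → adj G p q ≡ true → X P q ≡ true) {q : V G} (Xq : X P q ≡ false) where
      private
        B : VSet G
        B z = eqF z q

        escape : ∀ {x} → X P x ≡ true → ¬ x ~ q
        escape xx p = true≢false (walk-closed (λ u → X P u ≡ true) (λ _ _ e xu → closed _ _ xu e) p xx) Xq

        B≡ : ∀ {y z} → B y ≡ true → B z ≡ true → y ≡ z
        B≡ {y} {z} by bz = trans (eqF⇒≡ y q by) (≡-sym (eqF⇒≡ z q bz))

        disjoint : ∀ z → B z ≡ true → X P z ≡ true → ⊥
        disjoint z bz xz = true≢false (subst (λ u → X P u ≡ true) (eqF⇒≡ z q bz) xz) Xq

        sparse' : SparseBag d G B
        sparse' = record { attached = λ _ _ bx by _ _ → B≡ bx by ; sparse = spa }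
          where
          spa : ∀ x → B x ≡ true → count (λ y → B y ∧ adj G x y) ≤ d
          -- B holds only q, so the counted set is empty and its index type embeds into any `Fin d`.
          spa x bx = injective⇒≤ {f = λ i → ⊥-elim (none i)} λ {i} → ⊥-elim (none i)
            where
            E = enumerate (λ y → B y ∧ adj G x y)
            none : ¬ Fin (count (λ y → B y ∧ adj G x y))
            none i = let by , xy = ∧-true⁻ (B (elem E i)) (elem-true E i) in adj⇒≢ G xy (B≡ bx by)

        no-cross : ∀ x y → X P x ≡ true → B x ≡ false → B y ≡ true → X P y ≡ false → ¬ x ≈ y
        no-cross x y xx _ by _ (x~y , _) = escape xx (subst (x ~_) (eqF⇒≡ y q by) x~y)

        convex' : ∀ x y → X P x ∨ B x ≡ true → X P y ∨ B y ≡ true → x ~ y →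
                  ∀ c → X P c ∨ B c ≡ false → x ~[ c ] y
        convex' x y ex ey x~y c ec = go (∨-true⁻ (X P x) ex) (∨-true⁻ (X P y) ey)
          where
          go : X P x ≡ true ⊎ B x ≡ true → X P y ≡ true ⊎ B y ≡ true → x ~[ c ] y
          go (inj₁ xx) (inj₁ xy) = convex P x y xx xy x~y c (proj₁ (∨-false⁻ (X P c) ec))
          go (inj₁ xx) (inj₂ by) = ⊥-elim (escape xx (subst (x ~_) (eqF⇒≡ y q by) x~y))
          go (inj₂ bx) (inj₁ xy) = ⊥-elim (escape xy (subst (y ~_) (eqF⇒≡ x q bx) (reverse-walk x~y)))
          go (inj₂ bx) (inj₂ by) = subst (λ z → x ~[ c ] z) (B≡ bx by) (here (avoid⁺ x≢c))
            where
            x≢c : x ≢ c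
            x≢c refl = true≢false bx (proj₂ (∨-false⁻ (X P c) ec))

        root : V (Tr P)
        root = fromℕ< (proj₁ (isTree P))

        B∩X⊆ : ∀ z → B z ≡ true → X P z ≡ true → bag P root z ≡ true
        B∩X⊆ z bz xz = ⊥-elim (disjoint z bz xz)

      extendByVertex : Σ (Partial d) λ P' → count (not ∘ X P') < count (not ∘ X P)
      extendByVertex = extend B root sparse' B∩X⊆ B∩X≤1 no-cross B-block convex' Xq (eqF-refl q)
        where
        B∩X≤1 : ∀ y z → B y ≡ true → X P y ≡ true → B z ≡ true → X P z ≡ true → y ≡ z
        B∩X≤1 y z by _ bz _ = B≡ by bz
        B-block : ∀ x y → B x ≡ true → B y ≡ true → x ≢ y → x ≈ y → ∀ z → z ≈ x → z ≈ y → B z ≡ true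
        B-block x y bx by x≢y = contradiction (B≡ bx by) x≢y

  -- Every step brings a new vertex into X, so the number of missing vertices decreases. A single
  -- vertex is added only when no edge leaves X, that is, to start a new component.
  complete : ∀ {d} → FanFree d G → (P : Partial d) → Acc _<_ (count (not ∘ X P)) →
    Σ (Partial d) λ P' → ∀ v → X P' v ≡ true
  complete ff P (acc rec)
    with any? (λ p → any? λ q → X P p Bool.≟ true ×-dec X P q Bool.≟ false ×-dec adj G p q Bool.≟ true)
  ... | yes (p , q , Xp , Xq , pq) = let P' , less = extendByBlock P ff Xp Xq pq in complete ff P' (rec less)
  ... | no none with any? (λ q → X P q Bool.≟ false)
  ...   | yes (q , Xq) = let P' , less = extendByVertex P closed Xq in complete ff P' (rec less)
    where
    closed : ∀ p q → X P p ≡ true → adj G p q ≡ true → X P q ≡ true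
    closed p q Xp pq = Bool.¬-not λ Xq → none (p , q , Xp , Xq , pq)
  ...   | no all = P , λ v → Bool.¬-not λ Xv → all (v , Xv)

  fanFree⇒oneSums : ∀ {d} → FanFree d G → OneSums (MaxDegLe d) G
  fanFree⇒oneSums ff with complete ff emptyPartial (<-wellFounded _)
  ... | P , full = D , adhesion P , λ t → sparseBag⇒torso (bagSparse P t)
    where
    covers : ∀ u v → adj G u v ≡ true → ∃ λ t → bag P t u ≡ true × bag P t v ≡ true
    covers u v uv with blocks P u v (full u) (full v) (adj⇒≢ G uv) (adj⇒≈ uv)
    ... | t , h = t , h u ≈-refl (adj⇒≈ uv) , h v (≈-sym (adj⇒≈ uv)) ≈-refl
    D : TreeDecomposition G
    D = record { T = Tr P ; tree = isTree P ; β = bag P ; coverV = λ v → X⊆bag P v (full v)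
               ; coverE = covers ; connV = conn P }

-- Parities

sum-false : ∀ {k} {f : Fin k → Bool} → (∀ i → f i ≡ false) → sum f ≡ false
sum-false {k} f≡ = trans (sum-cong-≗ f≡) (sum-replicate-zero k)

sum-point : ∀ {k} (g : Fin k → Bool) j → sum (λ i → g i ∧ eqF i j) ≡ g j
sum-point {suc k} g zero =
  trans (cong₂ _xor_ (Bool.∧-identityʳ (g zero)) (sum-false {f = λ i → g (suc i) ∧ false} λ i → Bool.∧-zeroʳ _)) (Bool.xor-identityʳ _)
sum-point {suc k} g (suc j) = trans (cong (_xor sum (λ i → g (suc i) ∧ eqF i j)) (Bool.∧-zeroʳ (g zero))) (sum-point (g ∘ suc) j)

eqF-sym : ∀ {k} (i j : Fin k) → eqF i j ≡ eqF j i
eqF-sym zero    zero    = refl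
eqF-sym zero    (suc _) = refl
eqF-sym (suc _) zero    = refl
eqF-sym (suc i) (suc j) = eqF-sym i j

-- Handshake lemma over 𝔽₂: row and column zero cancel by symmetry, and the rest is smaller. Both
-- obstructions to a twist, the one from oddomorphisms and the one from the identity of G, end here.
sum-symmetric : ∀ {k} (s : Fin k → Fin k → Bool) → (∀ a b → s a b ≡ s b a) → (∀ a → s a a ≡ false) →
  sum (λ a → sum (s a)) ≡ false
sum-symmetric {zero}  s _ _ = refl
sum-symmetric {suc k} s s-sym s-diag = begin
  (s zero zero xor r) xor sum (λ a → s (suc a) zero xor sum (λ b → s (suc a) (suc b)))
    ≡⟨ cong₂ (λ x y → (x xor r) xor y) (s-diag zero) (∑-distrib-+ (λ a → s (suc a) zero) _) ⟩
  r xor (sum (λ a → s (suc a) zero) xor sum (λ a → sum (λ b → s (suc a) (suc b))))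
    ≡⟨ cong₂ (λ x y → r xor (x xor y)) (sum-cong-≗ λ a → s-sym (suc a) zero)
         (sum-symmetric (λ a b → s (suc a) (suc b)) (λ a b → s-sym (suc a) (suc b)) (λ a → s-diag (suc a))) ⟩
  r xor (r xor false) ≡⟨ cong (r xor_) (Bool.xor-identityʳ r) ⟩
  r xor r             ≡⟨ Bool.xor-same r ⟩
  false ∎
  where
  open ≡-Reasoning
  r = sum (λ b → s zero (suc b))

parity : (G : Graph) → V G → (V G → Bool) → Bool
parity G u y = sum λ w → adj G u w ∧ y w

module _ (G : Graph) (u : V G) where

  parity-cong : ∀ {y z} → y ≗ z → parity G u y ≡ parity G u z
  parity-cong y≗z = sum-cong-≗ λ w → cong (adj G u w ∧_) (y≗z w)

  parity-xor : ∀ y z → parity G u (λ w → y w xor z w) ≡ parity G u y xor parity G u z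
  parity-xor y z = trans (sum-cong-≗ λ w → Bool.∧-distribˡ-xor (adj G u w) (y w) (z w)) (∑-distrib-+ (λ w → adj G u w ∧ y w) _)

  parity-false : parity G u (λ _ → false) ≡ false
  parity-false = sum-false λ w → Bool.∧-zeroʳ (adj G u w)

  parity-point : ∀ q → parity G u (λ w → eqF w q) ≡ adj G u q
  parity-point = sum-point (adj G u)

  parity-sum : ∀ {k} (y : Fin k → V G → Bool) → parity G u (λ w → sum λ i → y i w) ≡ sum (λ i → parity G u (y i))
  parity-sum y = trans (sum-cong-≗ λ w → *-distribˡ-sum (adj G u w) (λ i → y i w)) (∑-comm (λ w i → adj G u w ∧ y i w))

single : ∀ {k} → Fin k → Fin k → Fin k → Fin k → Bool
single p q u w = (eqF u p ∧ eqF w q) xor (eqF u q ∧ eqF w p)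

single-sym : ∀ {k} (p q u w : Fin k) → single p q u w ≡ single p q w u
single-sym p q u w = trans (Bool.xor-comm (eqF u p ∧ eqF w q) _) (cong₂ _xor_ (Bool.∧-comm (eqF u q) _) (Bool.∧-comm (eqF u p) _))

-- The edges traversed an odd number of times by a walk, as a symmetric Boolean matrix.
trace : ∀ {G S p q} → Walk G S p q → V G → V G → Bool
trace (here _) u w = false
trace (step {p} {r} _ _ W) u w = single p r u w xor trace W u w

trace-sym : ∀ {G S p q} (W : Walk G S p q) u w → trace W u w ≡ trace W w u
trace-sym (here _) u w = refl
trace-sym (step _ _ W) u w = cong₂ _xor_ (single-sym _ _ u w) (trace-sym W u w)

single-parity : ∀ G {p q} → adj G p q ≡ true → ∀ u → parity G u (single p q u) ≡ eqF u p xor eqF u q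
single-parity G {p} {q} pq u = trans (parity-xor G u _ _) (cong₂ _xor_ (half pq) (half (adj-sym G pq)))
  where
  half : ∀ {p q} → adj G p q ≡ true → parity G u (λ w → eqF u p ∧ eqF w q) ≡ eqF u p
  half {p} {q} pq with eqF u p in up
  ... | false = parity-false G u
  ... | true rewrite eqF⇒≡ u p up = trans (parity-point G p q) pq

-- The 𝔽₂-boundary of a walk: consecutive edges cancel at inner vertices and only the ends remain.
trace-parity : ∀ {G S p q} (W : Walk G S p q) u → parity G u (trace W u) ≡ eqF u p xor eqF u q
trace-parity {G} {p = p} (here _) u = trans (parity-false G u) (≡-sym (Bool.xor-same (eqF u p)))
trace-parity {G} {p = p} {q} (step {w = r} _ pr W) u = begin
  parity G u (λ w → single p r u w xor trace W u w)
    ≡⟨ parity-xor G u _ _ ⟩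
  parity G u (single p r u) xor parity G u (trace W u)
    ≡⟨ cong₂ _xor_ (single-parity G pr u) (trace-parity W u) ⟩
  (eqF u p xor eqF u r) xor (eqF u r xor eqF u q)
    ≡⟨ telescope (eqF u p) (eqF u r) (eqF u q) ⟩
  eqF u p xor eqF u q ∎
  where
  open ≡-Reasoning
  telescope : ∀ a b c → (a xor b) xor (b xor c) ≡ a xor c
  telescope false b c = trans (≡-sym (Bool.xor-assoc b b c)) (cong (_xor c) (Bool.xor-same b))
  telescope true false c = refl
  telescope true true false = refl
  telescope true true true = refl

trace-avoid : ∀ {G v p q} (W : Walk G (avoid {G} v) p q) w → trace W v w ≡ false
trace-avoid (here _) w = refl
trace-avoid {v = v} (step {p} {r} p≢ _ W) w
  rewrite ≢⇒eqF (≢-sym (avoid⁻ {x = p} p≢)) | ≢⇒eqF (≢-sym (avoid⁻ {x = r} (walk-source W))) = trace-avoid W w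

-- Twisted lifts as a linear system

first : ∀ {m} → (Fin (suc m) → Bool) → Fin (suc m)
-- Default: if no index is true, the last one is returned.
first {zero}  p = zero
first {suc m} p = if p zero then zero else suc (first (p ∘ suc))

first-true : ∀ {m} (p : Fin (suc m) → Bool) i → p i ≡ true → p (first p) ≡ true
first-true {zero}  p zero pi = pi
first-true {suc m} p i pi with p zero in p0
... | true = p0
first-true {suc m} p zero    pi | false = ⊥-elim (true≢false pi p0)
first-true {suc m} p (suc i) pi | false = first-true (p ∘ suc) i pi

first-cong : ∀ {m} {p q : Fin (suc m) → Bool} → p ≗ q → first p ≡ first q
first-cong {zero}  _   = refl
first-cong {suc m} p≗q = cong₂ (λ b j → if b then zero else suc j) (p≗q zero) (first-cong (p≗q ∘ suc))

-- Lifts of φ to a CFI graph of G are the solutions of this linear system over 𝔽₂, where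
-- bit a w is the label that a assigns to the edge from φ a to w.
record Twist (F G : Graph) (φ : V F → V G) (t : V F → Bool) : Set where
  field
    bit     : V F → V G → Bool
    charge  : ∀ a → parity G (φ a) (bit a) ≡ t a
    agree   : ∀ a b → adj F a b ≡ true → bit a (φ b) ≡ bit b (φ a)
open Twist

zeroTwist : ∀ {F G φ} → Twist F G φ (λ _ → false)
zeroTwist {G = G} {φ} = record
  { bit = λ _ _ → false ; charge = λ a → parity-false G (φ a) ; agree = λ _ _ _ → refl }

sumTwist : ∀ {F G φ k} {t : Fin k → V F → Bool} → (∀ i → Twist F G φ (t i)) → Twist F G φ (λ a → sum λ i → t i a)
sumTwist {G = G} {φ} τ = record
  { bit    = λ a w → sum λ i → bit (τ i) a w
  ; charge = λ a → trans (parity-sum G (φ a) (λ i → bit (τ i) a)) (sum-cong-≗ λ i → charge (τ i) a)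
  ; agree  = λ a b ab → sum-cong-≗ λ i → agree (τ i) a b ab }

module PointTwist {d : ℕ} {F G : Graph} (ff : FanFree d F) (φ : V F → V G)
  (a₀ : V F) (Φ : Fan (suc d) G (φ a₀)) where

  private
    v = φ a₀

  loop : Fin (suc d) → V G → V G → Bool
  loop i u w = single v (tip Φ zero) u w xor (trace (linked Φ zero i) u w xor single (tip Φ i) v u w)

  loop-sym : ∀ i u w → loop i u w ≡ loop i w u
  loop-sym i u w = cong₂ _xor_ (single-sym v _ u w) (cong₂ _xor_ (trace-sym (linked Φ zero i) u w) (single-sym _ v u w))

  loop-parity : ∀ i u → parity G u (loop i u) ≡ false
  loop-parity i u = begin
    parity G u (loop i u)
      ≡⟨ parity-xor G u _ _ ⟩
    parity G u (single v w₀ u) xor parity G u (λ w → trace (linked Φ zero i) u w xor single (tip Φ i) v u w)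
      ≡⟨ cong₂ _xor_ (single-parity G (spoke Φ zero) u) (trans (parity-xor G u _ _)
           (cong₂ _xor_ (trace-parity (linked Φ zero i) u) (single-parity G (adj-sym G (spoke Φ i)) u))) ⟩
    (eqF u v xor eqF u w₀) xor ((eqF u w₀ xor eqF u (tip Φ i)) xor (eqF u (tip Φ i) xor eqF u v))
      ≡⟨ closed (eqF u v) (eqF u w₀) (eqF u (tip Φ i)) ⟩
    false ∎
    where
    open ≡-Reasoning
    w₀ = tip Φ zero
    closed : ∀ a b c → (a xor b) xor ((b xor c) xor (c xor a)) ≡ false
    closed false false false = refl
    closed false false true  = refl
    closed false true  false = refl
    closed false true  true  = refl
    closed true  false false = refl
    closed true  false true  = refl
    closed true  true  false = refl
    closed true  true  true  = refl

  -- The linking walk avoids v, so only the two spokes are visible there; for i = 0 they cancel.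
  loop-at-v : ∀ i w → loop i v w ≡ eqF w (tip Φ zero) xor eqF w (tip Φ i)
  loop-at-v i w rewrite trace-avoid (linked Φ zero i) w | eqF-refl v
    | ≢⇒eqF (adj⇒≢ G (spoke Φ zero)) | ≢⇒eqF (adj⇒≢ G (spoke Φ i)) = cong (_xor eqF w (tip Φ i)) (Bool.xor-identityʳ (eqF w (tip Φ zero)))

  Hit : V F → Fin (suc d) → Set
  Hit b i = ∃ λ b' → adj F a₀ b' ≡ true × Walk F (avoid {F} a₀) b b' × φ b' ≡ tip Φ i

  hit? : ∀ b i → Dec (Hit b i)
  hit? b i = any? λ b' → (adj F a₀ b' Bool.≟ true) ×-dec walk? F _ b b' ×-dec (φ b' ≟ tip Φ i)

  missed : V F → Fin (suc d)
  missed b = first (λ i → not (does (hit? b i)))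

  hits⇒fan : ∀ {b} → (∀ i → Hit b i) → Fan (suc d) F a₀
  hits⇒fan h = record
    { tip = λ i → proj₁ (h i)
    ; tip-inj = λ {i} {j} e → tip-inj Φ (trans (≡-sym (at i)) (trans (cong φ e) (at j)))
    ; spoke = λ i → proj₁ (proj₂ (h i))
    ; linked = λ i j → reverse-walk (to i) ++ʷ to j }
    where
    at = λ i → proj₂ (proj₂ (proj₂ (h i)))
    to = λ i → proj₁ (proj₂ (proj₂ (h i)))

  missed-unhit : ∀ b → ¬ Hit b (missed b)
  missed-unhit b h with any? (λ i → ¬? (hit? b i))
  ... | yes (i , ¬h) = true≢false (dec-true (hit? b _) h)
          (Bool.not-injective (first-true (λ i → not (does (hit? b i))) i (cong not (dec-false (hit? b i) ¬h))))
  ... | no all = ff a₀ (hits⇒fan {b} λ i → decidable-stable (hit? b i) λ ¬h → all (i , ¬h))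

  -- Both ends lie in one component of F - a₀, so they hit the same fibres, and `first` depends only
  -- on the values of its predicate. Thus a whole component uses a single loop.
  missed-edge : ∀ {b b'} → b ≢ a₀ → b' ≢ a₀ → adj F b b' ≡ true → missed b ≡ missed b'
  missed-edge b≢ b'≢ e = first-cong λ i → cong not
    (does-⇔ (mk⇔ (move (adj-sym F e) b'≢ b≢) (move e b≢ b'≢)) (hit? _ i) (hit? _ i))
    where
    move : ∀ {b b' i} → adj F b b' ≡ true → b ≢ a₀ → b' ≢ a₀ → Hit b' i → Hit b i
    move e b≢ b'≢ (c , a₀c , p , φc) = c , a₀c , step (avoid⁺ b≢) e p , φc

  private
    x : V F → V G → Bool
    x b w = if eqF b a₀ then eqF w (tip Φ zero) else loop (missed b) (φ b) w

    x-at : ∀ {b} → b ≡ a₀ → ∀ w → x b w ≡ eqF w (tip Φ zero)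
    x-at refl w = cong (if_then eqF w (tip Φ zero) else loop (missed a₀) v w) (eqF-refl a₀)

    x-off : ∀ {b} → b ≢ a₀ → ∀ w → x b w ≡ loop (missed b) (φ b) w
    x-off {b} b≢ w = cong (if_then eqF w (tip Φ zero) else loop (missed b) (φ b) w) (≢⇒eqF b≢)

    x-parity : ∀ b → parity G (φ b) (x b) ≡ eqF a₀ b
    x-parity b with b ≟ a₀
    ... | yes refl = trans (parity-cong G v (x-at refl)) (trans (parity-point G v _) (trans (spoke Φ zero) (≡-sym (eqF-refl a₀))))
    ... | no b≢ = trans (parity-cong G (φ b) (x-off b≢)) (trans (loop-parity (missed b) (φ b)) (≡-sym (≢⇒eqF (≢-sym b≢))))

    -- The loop used on the component of b skips the spoke of a fibre in which a₀ has no
    -- neighbour in that component, so it agrees with the bits of a₀ on all edges to b.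
    x-boundary : ∀ {b} → adj F a₀ b ≡ true → x a₀ (φ b) ≡ x b (φ a₀)
    x-boundary {b} e = begin
      x a₀ (φ b)                  ≡⟨ x-at refl (φ b) ⟩
      eqF (φ b) w₀                ≡⟨ ≡-sym (Bool.xor-identityʳ _) ⟩
      eqF (φ b) w₀ xor false      ≡⟨ cong (eqF (φ b) w₀ xor_) (≡-sym (≢⇒eqF not-hit)) ⟩
      eqF (φ b) w₀ xor eqF (φ b) (tip Φ i) ≡⟨ ≡-sym (loop-at-v i (φ b)) ⟩
      loop i v (φ b)              ≡⟨ loop-sym i v (φ b) ⟩
      loop i (φ b) v              ≡⟨ ≡-sym (x-off b≢ v) ⟩
      x b v ∎
      where
      open ≡-Reasoning
      w₀ = tip Φ zero
      i = missed b
      b≢ : b ≢ a₀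
      b≢ = ≢-sym (adj⇒≢ F e)
      not-hit : φ b ≢ tip Φ i
      not-hit φb≡ = missed-unhit b (b , e , here (avoid⁺ b≢) , φb≡)

    x-agree : ∀ a b → adj F a b ≡ true → x a (φ b) ≡ x b (φ a)
    x-agree a b e with a ≟ a₀ | b ≟ a₀
    ... | yes refl | _        = x-boundary e
    ... | no _     | yes refl = ≡-sym (x-boundary (adj-sym F e))
    ... | no a≢    | no b≢    = begin
      x a (φ b)                     ≡⟨ x-off a≢ (φ b) ⟩
      loop (missed a) (φ a) (φ b)   ≡⟨ loop-sym (missed a) (φ a) (φ b) ⟩
      loop (missed a) (φ b) (φ a)   ≡⟨ cong (λ i → loop i (φ b) (φ a)) (missed-edge a≢ b≢ e) ⟩
      loop (missed b) (φ b) (φ a)   ≡⟨ ≡-sym (x-off b≢ (φ a)) ⟩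
      x b (φ a) ∎
      where open ≡-Reasoning

  pointTwist : Twist F G φ (eqF a₀)
  pointTwist = record { bit = x ; charge = x-parity ; agree = x-agree }

fibreTwist : ∀ {d F G v} → FanFree d F → Fan (suc d) G v → ∀ φ → Twist F G φ (λ a → eqF (φ a) v)
fibreTwist {d} {F} {G} {v} ff Φ φ = record
  { bit = bit total ; charge = λ a → trans (charge total a) (sum-point (λ a₀ → eqF (φ a₀) v) a) ; agree = agree total }
  where
  local : ∀ a₀ → Twist F G φ (λ a → eqF (φ a₀) v ∧ eqF a₀ a)
  local a₀ with eqF (φ a₀) v in e
  ... | false = zeroTwist
  ... | true  = PointTwist.pointTwist ff φ a₀ (subst (Fan (suc d) G) (≡-sym (eqF⇒≡ (φ a₀) v e)) Φ)
  total = sumTwist local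

-- Oddomorphisms exclude twists

allB⁺ : ∀ {A : Set} {p : A → Bool} xs → (∀ x → p x ≡ true) → allB p xs ≡ true
allB⁺ []       h = refl
allB⁺ (x ∷ xs) h = ∧-true (h x) (allB⁺ xs h)

allB-false : ∀ {A : Set} {p : A → Bool} xs → allB p xs ≡ false → ∃ λ x → p x ≡ false
allB-false {p = p} (x ∷ xs) e with p x in px
... | false = x , px
... | true  = allB-false xs e

allB⁻ : ∀ {A : Set} {p : A → Bool} {xs x} → allB p xs ≡ true → x ∈ xs → p x ≡ true
allB⁻ {p = p} {y ∷ ys} e (here refl) = proj₁ (∧-true⁻ (p y) e)
allB⁻ {p = p} {y ∷ ys} e (there x∈)  = allB⁻ {p = p} (proj₂ (∧-true⁻ (p y) e)) x∈

count%2 : ∀ {k} (p : Fin k → Bool) → count p % 2 ≡ (if sum p then 1 else 0)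
count%2 {zero}  p = refl
count%2 {suc k} p with p zero
... | false = count%2 (p ∘ suc)
... | true  = suc%2 (count (p ∘ suc)) (sum (p ∘ suc)) (count%2 (p ∘ suc))
  where
  suc%2 : ∀ m b → m % 2 ≡ (if b then 1 else 0) → suc m % 2 ≡ (if not b then 1 else 0)
  suc%2 zero          false _ = refl
  suc%2 (suc zero)    true  _ = refl
  suc%2 (suc (suc m)) b     e = suc%2 m b e

odd⇒sum : ∀ {k} (p : Fin k → Bool) → Odd (count p) → sum p ≡ true
odd⇒sum p o with sum p | count%2 p
... | true  | _ = refl
... | false | e with () ← trans (≡-sym o) e

even⇒sum : ∀ {k} (p : Fin k → Bool) → Even (count p) → sum p ≡ false
even⇒sum p o with sum p | count%2 p
... | false | _ = refl
... | true  | e with () ← trans (≡-sym o) e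

module _ {F G : Graph} {φ : V F → V G} (S : Subgraph F) where

  odd⇒isOddB : ∀ a → IsOddVertex F G S φ a → isOddB F G S φ a ≡ true
  odd⇒isOddB a odd with isOddB F G S φ a in eq
  ... | true = refl
  ... | false with allB-false (allFin (n G)) eq
  ...   | w , e with adj G (φ a) w in aw
  ...     | false with () ← e
  ...     | true rewrite odd w aw with () ← e

  -- The neighbour w is essential: over an isolated vertex of G, a is both odd and even, and
  -- `isOddB` then answers `true`.
  even⇒¬isOddB : ∀ a → IsEvenVertex F G S φ a → ∀ {w} → adj G (φ a) w ≡ true → isOddB F G S φ a ≡ false
  even⇒¬isOddB a even {w} aw with isOddB F G S φ a in eq
  ... | false = refl
  ... | true with allB⁻ eq (∈-allFin w)
  ...   | e rewrite aw | even w aw with () ← e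

  -- Over the vertices of S, multiplying the charge by the odd vertices turns it into a sum over
  -- the edges of S; as twists agree along edges, every edge is then counted twice.
  oddomorphism-twist : IsHom F G φ → IsOddoOn F G S φ → ∀ v → ¬ Twist F G φ (λ a → eqF (φ a) v)
  oddomorphism-twist φ-hom (oddOrEven , oddFibre) v τ =
    true≢false (odd⇒sum (λ a → inV S a ∧ (eqF (φ a) v ∧ isOddB F G S φ a)) (oddFibre v)) (trans (sum-cong-≗ vertex) (sum-symmetric half half-sym half-diag))
    where
    open ≡-Reasoning
    half : V F → V F → Bool
    half a b = inE S a b ∧ bit τ a (φ b)

    half-sym : ∀ a b → half a b ≡ half b a
    half-sym a b rewrite Esym S b a with inE S a b in e
    ... | false = refl
    ... | true  = agree τ a b (E⊆ S a b e)

    half-diag : ∀ a → half a a ≡ false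
    half-diag a with inE S a a in e
    ... | false = refl
    ... | true  = ⊥-elim (true≢false (E⊆ S a a e) (loopless F a))

    inFibre : V F → V G → V F → Bool
    inFibre a w b = inV S b ∧ (inE S a b ∧ eqF (φ b) w)

    -- A vertex that is odd or even has the same parity over all neighbours of φ a, so its oddness
    -- may be read off at whichever w the accompanying bit refers to.
    odd-parity : ∀ {a w} → inV S a ≡ true → adj G (φ a) w ≡ true →
      isOddB F G S φ a ≡ sum (inFibre a w)
    odd-parity {a} {w} a∈ aw with oddOrEven a a∈
    ... | inj₁ odd  = trans (odd⇒isOddB a odd) (≡-sym (odd⇒sum (inFibre a w) (odd w aw)))
    ... | inj₂ even = trans (even⇒¬isOddB a even aw) (≡-sym (even⇒sum (inFibre a w) (even w aw)))

    -- For a non-neighbour w of φ a both sides vanish, since φ maps the edges of S at a to edges of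
    -- G.
    direction : ∀ {a} → inV S a ≡ true → ∀ w →
      (adj G (φ a) w ∧ bit τ a w) ∧ isOddB F G S φ a ≡ sum (λ b → (inE S a b ∧ bit τ a w) ∧ eqF w (φ b))
    direction {a} a∈ w with adj G (φ a) w in aw
    ... | false = ≡-sym (sum-false none)
      where
      none : ∀ b → (inE S a b ∧ bit τ a w) ∧ eqF w (φ b) ≡ false
      none b = Bool.¬-not λ e →
        let ab , wb = ∧-true⁻ (inE S a b ∧ bit τ a w) e
        in true≢false (subst (λ z → adj G (φ a) z ≡ true) (≡-sym (eqF⇒≡ w (φ b) wb))
             (φ-hom a b (E⊆ S a b (proj₁ (∧-true⁻ (inE S a b) ab))))) aw
    ... | true = begin
      bit τ a w ∧ isOddB F G S φ a
        ≡⟨ cong (bit τ a w ∧_) (odd-parity a∈ aw) ⟩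
      bit τ a w ∧ sum (inFibre a w)
        ≡⟨ *-distribˡ-sum (bit τ a w) (inFibre a w) ⟩
      sum (λ b → bit τ a w ∧ inFibre a w b)
        ≡⟨ sum-cong-≗ regroup ⟩
      sum (λ b → (inE S a b ∧ bit τ a w) ∧ eqF w (φ b)) ∎
      where
      regroup : ∀ b → bit τ a w ∧ inFibre a w b ≡ (inE S a b ∧ bit τ a w) ∧ eqF w (φ b)
      regroup b with inE S a b in e
      ... | false = trans (cong (bit τ a w ∧_) (Bool.∧-zeroʳ (inV S b))) (Bool.∧-zeroʳ (bit τ a w))
      ... | true rewrite Eend S b a (trans (Esym S b a) e) = cong (bit τ a w ∧_) (eqF-sym (φ b) w)

    vertex : ∀ a → inV S a ∧ (eqF (φ a) v ∧ isOddB F G S φ a) ≡ sum (half a)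
    vertex a with inV S a in a∈
    ... | false = ≡-sym (sum-false none)
      where
      none : ∀ b → half a b ≡ false
      none b = Bool.¬-not λ e → true≢false (Eend S a b (proj₁ (∧-true⁻ (inE S a b) e))) a∈
    ... | true = begin
      eqF (φ a) v ∧ isOddB F G S φ a
        ≡⟨ cong (_∧ isOddB F G S φ a) (≡-sym (charge τ a)) ⟩
      parity G (φ a) (bit τ a) ∧ isOddB F G S φ a
        ≡⟨ *-distribʳ-sum (isOddB F G S φ a) (λ w → adj G (φ a) w ∧ bit τ a w) ⟩
      sum (λ w → (adj G (φ a) w ∧ bit τ a w) ∧ isOddB F G S φ a)
        ≡⟨ sum-cong-≗ (direction a∈) ⟩
      sum (λ w → sum (λ b → (inE S a b ∧ bit τ a w) ∧ eqF w (φ b)))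
        ≡⟨ ∑-comm (λ w b → (inE S a b ∧ bit τ a w) ∧ eqF w (φ b)) ⟩
      sum (λ b → sum (λ w → (inE S a b ∧ bit τ a w) ∧ eqF w (φ b)))
        ≡⟨ sum-cong-≗ (λ b → sum-point (λ w → inE S a b ∧ bit τ a w) (φ b)) ⟩
      sum (half a) ∎

fanFree-closed : ∀ d → ClosedUnderWeakOddomorphisms (FanFree d)
fanFree-closed d F G φ ff (φ-hom , S , oddo) v Φ = oddomorphism-twist S φ-hom oddo v (fibreTwist ff Φ φ)

-- Homomorphism counts

allFin-unique : ∀ k → AllPairs _≢_ (allFin k)
allFin-unique zero    = []
allFin-unique (suc k) = All.map⁺ (All.universal (λ _ ()) _)
  ∷ AllPairs.map⁺ (AllPairs.map (λ i≢j e → i≢j (suc-injective e)) (allFin-unique k))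

-- Functions are compared pointwise throughout. Together with `allFuns-complete` this makes the
-- length of the filtered list a count of homomorphisms up to pointwise equality.
allFuns-unique : ∀ k m → AllPairs (λ f g → ¬ f ≗ g) (allFuns k m)
allFuns-unique zero    m = [] ∷ []
allFuns-unique (suc k) m = AllPairs.concat⁺
  (All.map⁺ (All.universal (λ x → AllPairs.map⁺ (AllPairs.map (λ f≇g e → f≇g (e ∘ suc)) (allFuns-unique k m))) _))
  (AllPairs.map⁺ (AllPairs.map (λ x≢y → All.map⁺ (All.universal (λ f → All.map⁺ (All.universal (λ g e → x≢y (e zero)) _)) _))
    (allFin-unique m)))

allFuns-complete : ∀ k m (f : Fin k → Fin m) → Any (f ≗_) (allFuns k m)
allFuns-complete zero    m f = here λ ()
allFuns-complete (suc k) m f = Any.concatMap⁺ _ (Any.map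
  (λ { refl → Any.map⁺ (Any.map (λ e → λ { zero → refl ; (suc i) → e i }) (allFuns-complete k m (f ∘ suc))) })
  (∈-allFin (f zero)))

implB⁺ : ∀ a {b} → (a ≡ true → b ≡ true) → implB a b ≡ true
implB⁺ true  h = h refl
implB⁺ false _ = refl

implB⁻ : ∀ {a b} → implB a b ≡ true → a ≡ true → b ≡ true
implB⁻ e refl = e

isHomB⁺ : ∀ F K {φ : V F → V K} → IsHom F K φ → isHomB F K φ ≡ true
isHomB⁺ F K φ-hom = allB⁺ (allFin (n F)) λ a → allB⁺ (allFin (n F)) λ b → implB⁺ (adj F a b) (φ-hom a b)

isHomB⁻ : ∀ F K {φ : V F → V K} → isHomB F K φ ≡ true → IsHom F K φ
isHomB⁻ F K e a b = implB⁻ (allB⁻ (allB⁻ e (∈-allFin a)) (∈-allFin b))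

isHom-resp : ∀ F K {φ χ : V F → V K} → φ ≗ χ → IsHom F K φ → IsHom F K χ
isHom-resp F K φ≗χ φ-hom a b ab = subst (_≡ true) (cong₂ (adj K) (φ≗χ a) (φ≗χ b)) (φ-hom a b ab)

isHom? : ∀ F K (φ : V F → V K) → Dec (IsHom F K φ)
isHom? F K φ = all? λ a → all? λ b → (adj F a b Bool.≟ true) →-dec (adj K (φ a) (φ b) Bool.≟ true)

module _ (F K : Graph) where

  homs : List (V F → V K)
  homs = filter (λ φ → isHomB F K φ Bool.≟ true) (allFuns (n F) (n K))

  homAt : Fin (hom F K) → V F → V K
  homAt = lookup homs

  homAt-isHom : ∀ i → IsHom F K (homAt i)
  homAt-isHom i = isHomB⁻ F K (All.lookup (All.all-filter (λ φ → isHomB F K φ Bool.≟ true) (allFuns (n F) (n K))) (∈-lookup i))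

  homAt-inj : ∀ i j → homAt i ≗ homAt j → i ≡ j
  homAt-inj = unique⇒lookup-inj (AllPairs.filter⁺ (λ φ → isHomB F K φ Bool.≟ true) (allFuns-unique (n F) (n K)))
    where
    unique⇒lookup-inj : ∀ {fs : List (V F → V K)} → AllPairs (λ f g → ¬ f ≗ g) fs →
      ∀ i j → lookup fs i ≗ lookup fs j → i ≡ j
    unique⇒lookup-inj (_ ∷ _)  zero    zero    _ = refl
    unique⇒lookup-inj (f≇ ∷ _) zero    (suc j) e = contradiction e (All.lookup f≇ (∈-lookup j))
    unique⇒lookup-inj (f≇ ∷ _) (suc i) zero    e = contradiction (λ a → ≡-sym (e a)) (All.lookup f≇ (∈-lookup i))
    unique⇒lookup-inj (_ ∷ fs) (suc i) (suc j) e = cong suc (unique⇒lookup-inj fs i j e)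

  homAt-index : ∀ φ → IsHom F K φ → ∃ λ i → φ ≗ homAt i
  homAt-index φ isHom = Any.index φ∈ , Any.lookup-index φ∈
    where
    φ∈ : Any (φ ≗_) homs
    φ∈ = ∈-filter⁺ (V F →-setoid V K) (λ φ → isHomB F K φ Bool.≟ true)
      (λ e h → isHomB⁺ F K (isHom-resp F K e (isHomB⁻ F K h))) (allFuns-complete (n F) (n K) φ) (isHomB⁺ F K isHom)

module HomInjection {F K K' : Graph} (τ : (V F → V K) → V F → V K')
  (τ-hom : ∀ φ → IsHom F K φ → IsHom F K' (τ φ)) (τ-inj : ∀ φ χ → τ φ ≗ τ χ → φ ≗ χ) where

  private
    at : ∀ i → ∃ λ j → τ (homAt F K i) ≗ homAt F K' j
    at i = homAt-index F K' _ (τ-hom _ (homAt-isHom F K i))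
    f : Fin (hom F K) → Fin (hom F K')
    f i = proj₁ (at i)
    f-inj : Injective _≡_ _≡_ f
    f-inj {i} {j} e = homAt-inj F K i j (τ-inj _ _ λ a →
      trans (proj₂ (at i) a) (trans (cong (λ k → homAt F K' k a) e) (≡-sym (proj₂ (at j) a))))

  hom-≤ : hom F K ≤ hom F K'
  hom-≤ = injective⇒≤ f-inj

  hom-< : ∀ χ → IsHom F K' χ → (∀ φ → IsHom F K φ → ¬ τ φ ≗ χ) → hom F K < hom F K'
  hom-< χ χ-hom missed = injective⇒≤ {f = g} g-inj
    where
    χ∈ = homAt-index F K' χ χ-hom
    g : Fin (suc (hom F K)) → Fin (hom F K')
    g zero    = proj₁ χ∈
    g (suc i) = f i
    off : ∀ i → proj₁ χ∈ ≢ f i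
    off i e = missed _ (homAt-isHom F K i) λ a →
      trans (proj₂ (at i) a) (trans (cong (λ k → homAt F K' k a) (≡-sym e)) (≡-sym (proj₂ χ∈ a)))
    g-inj : Injective _≡_ _≡_ g
    g-inj {zero}  {zero}  _ = refl
    g-inj {zero}  {suc j} e = ⊥-elim (off j e)
    g-inj {suc i} {zero}  e = ⊥-elim (off i (≡-sym e))
    g-inj {suc i} {suc j} e = cong suc (f-inj e)

-- CFI graphs

funToFin-cong : ∀ {k m} {f g : Fin k → Fin m} → f ≗ g → funToFin f ≡ funToFin g
funToFin-cong {zero}  _   = refl
funToFin-cong {suc k} f≗g = cong₂ combine (f≗g zero) (funToFin-cong (f≗g ∘ suc))

isOne : Fin 2 → Bool
isOne zero    = false
isOne (suc _) = true

toFin₂ : Bool → Fin 2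
toFin₂ false = zero
toFin₂ true  = suc zero

isOne-toFin₂ : ∀ b → isOne (toFin₂ b) ≡ b
isOne-toFin₂ false = refl
isOne-toFin₂ true  = refl

isOne-inj : ∀ i j → isOne i ≡ isOne j → i ≡ j
isOne-inj zero       zero       _ = refl
isOne-inj (suc zero) (suc zero) _ = refl

-- Fin (k * 2 ^ k) as the type of pairs of an element of Fin k and a subset of Fin k.
module Coded (k : ℕ) where

  pos : Fin (k * 2 ^ k) → Fin k
  pos z = proj₁ (remQuot (2 ^ k) z)

  bits : Fin (k * 2 ^ k) → Fin k → Bool
  bits z w = isOne (finToFun (proj₂ (remQuot {k} (2 ^ k) z)) w)

  pair : Fin k → (Fin k → Bool) → Fin (k * 2 ^ k)
  pair u y = combine u (funToFin (toFin₂ ∘ y))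

  pos-pair : ∀ u y → pos (pair u y) ≡ u
  pos-pair u y = cong proj₁ (remQuot-combine u (funToFin (toFin₂ ∘ y)))

  bits-pair : ∀ u y → bits (pair u y) ≗ y
  bits-pair u y w = trans (cong (λ c → isOne (finToFun (proj₂ c) w)) (remQuot-combine u (funToFin (toFin₂ ∘ y))))
    (trans (cong isOne (finToFun-funToFin (toFin₂ ∘ y) w)) (isOne-toFin₂ (y w)))

  pos-bits-inj : ∀ z z' → pos z ≡ pos z' → bits z ≗ bits z' → z ≡ z'
  pos-bits-inj z z' p b = trans (≡-sym (combine-remQuot {k} (2 ^ k) z))
    (trans (cong₂ combine p code≡) (combine-remQuot {k} (2 ^ k) z'))
    where
    c  = proj₂ (remQuot {k} (2 ^ k) z)
    c' = proj₂ (remQuot {k} (2 ^ k) z')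
    code≡ : c ≡ c'
    code≡ = trans (≡-sym (funToFin-finToFin {k} {2} c))
      (trans (funToFin-cong λ w → isOne-inj _ _ (b w)) (funToFin-finToFin {k} {2} c'))

  shift : {A : Set} → (A → Fin (k * 2 ^ k)) → (A → Fin k → Bool) → A → Fin (k * 2 ^ k)
  shift φ y a = pair (pos (φ a)) (λ w → bits (φ a) w xor y a w)

  pos-shift : ∀ {A : Set} (φ : A → Fin (k * 2 ^ k)) y a → pos (shift φ y a) ≡ pos (φ a)
  pos-shift φ y a = pos-pair _ _

  bits-shift : ∀ {A : Set} (φ : A → Fin (k * 2 ^ k)) y a w → bits (shift φ y a) w ≡ bits (φ a) w xor y a w
  bits-shift φ y a = bits-pair _ _

_==_ : Bool → Bool → Bool
a == b = not (a xor b)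

==⁺ : ∀ {a b} → a ≡ b → (a == b) ≡ true
==⁺ {a} refl = cong not (Bool.xor-same a)

==⁻ : ∀ {a b} → (a == b) ≡ true → a ≡ b
==⁻ {false} {false} _ = refl
==⁻ {true}  {true}  _ = refl

-- The CFI graph of G with charge U. A vertex carries one bit for every vertex of G, those of
-- non-neighbours being irrelevant, and vertices violating the parity condition are isolated.
module CFI (G : Graph) (U : V G → Bool) where

  open Coded (n G)

  charged : Fin (n G * 2 ^ n G) → Bool
  charged z = parity G (pos z) (bits z) == U (pos z)

  cfiAdj : Fin (n G * 2 ^ n G) → Fin (n G * 2 ^ n G) → Bool
  cfiAdj z z' = adj G (pos z) (pos z') ∧ ((bits z (pos z') == bits z' (pos z)) ∧ (charged z ∧ charged z'))

  cfi : Graph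
  cfi = record
    { n        = n G * 2 ^ n G
    ; adj      = cfiAdj
    ; sym      = λ z z' → cong₂ _∧_ (Graph.sym G (pos z) (pos z'))
                   (cong₂ _∧_ (cong not (Bool.xor-comm (bits z (pos z')) _)) (Bool.∧-comm (charged z) _))
    ; loopless = λ z → cong (_∧ ((bits z (pos z) == bits z (pos z)) ∧ (charged z ∧ charged z))) (loopless G (pos z))
    }

  cfiAdj⁻ : ∀ {z z'} → cfiAdj z z' ≡ true → adj G (pos z) (pos z') ≡ true ×
    bits z (pos z') ≡ bits z' (pos z) × parity G (pos z) (bits z) ≡ U (pos z)
  cfiAdj⁻ {z} {z'} e with ∧-true⁻ (adj G (pos z) (pos z')) e
  ... | a , e' with ∧-true⁻ (bits z (pos z') == bits z' (pos z)) e'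
  ... | b , e'' = a , ==⁻ b , ==⁻ (proj₁ (∧-true⁻ (charged z) e''))

  isHom⁺ : ∀ F {φ : V F → V cfi} → (∀ a b → adj F a b ≡ true → adj G (pos (φ a)) (pos (φ b)) ≡ true ×
    bits (φ a) (pos (φ b)) ≡ bits (φ b) (pos (φ a)) × parity G (pos (φ a)) (bits (φ a)) ≡ U (pos (φ a))) → IsHom F cfi φ
  isHom⁺ F h a b ab = let adj' , bit' , par = h a b ab in
    ∧-true adj' (∧-true (==⁺ bit') (∧-true (==⁺ par) (==⁺ (proj₂ (proj₂ (h b a (adj-sym F ab)))))))

open CFI using (cfi; cfiAdj⁻; isHom⁺)

module _ (F G : Graph) where

  open Coded (n G)

  -- The equations are linear over 𝔽₂: adding the bits of two lifts of one map adds their charges.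
  shift-hom : ∀ {U U' U''} → (∀ u → U u xor U' u ≡ U'' u) → ∀ {φ χ} →
    IsHom F (cfi G U) φ → IsHom F (cfi G U') χ → (∀ a → pos (χ a) ≡ pos (φ a)) →
    IsHom F (cfi G U'') (shift φ (λ a → bits (χ a)))
  shift-hom {U} {U'} {U''} UU' {φ} {χ} φ-hom χ-hom χ≗φ = isHom⁺ G U'' F edges
    where
    open ≡-Reasoning
    y = λ a → bits (χ a)
    σ = shift φ y
    pσ : ∀ a → pos (σ a) ≡ pos (φ a)
    pσ = pos-shift φ y
    edges : ∀ a b → adj F a b ≡ true → adj G (pos (σ a)) (pos (σ b)) ≡ true ×
      bits (σ a) (pos (σ b)) ≡ bits (σ b) (pos (σ a)) × parity G (pos (σ a)) (bits (σ a)) ≡ U'' (pos (σ a))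
    edges a b ab rewrite pσ a | pσ b with cfiAdj⁻ G U (φ-hom a b ab) | cfiAdj⁻ G U' (χ-hom a b ab)
    ... | adjφ , bitφ , parφ | _ , bitχ , parχ = adjφ , bit' , par'
      where
      bit' : bits (σ a) (pos (φ b)) ≡ bits (σ b) (pos (φ a))
      bit' = begin
        bits (σ a) (pos (φ b))                               ≡⟨ bits-shift φ y a _ ⟩
        bits (φ a) (pos (φ b)) xor bits (χ a) (pos (φ b))    ≡⟨ cong₂ _xor_ bitφ (subst (λ c → bits (χ a) c ≡ bits (χ b) (pos (φ a))) (χ≗φ b) (subst (λ c → bits (χ a) (pos (χ b)) ≡ bits (χ b) c) (χ≗φ a) bitχ)) ⟩
        bits (φ b) (pos (φ a)) xor bits (χ b) (pos (φ a))    ≡⟨ ≡-sym (bits-shift φ y b _) ⟩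
        bits (σ b) (pos (φ a)) ∎
      par' : parity G (pos (φ a)) (bits (σ a)) ≡ U'' (pos (φ a))
      par' = begin
        parity G (pos (φ a)) (bits (σ a))
          ≡⟨ parity-cong G _ (bits-shift φ y a) ⟩
        parity G (pos (φ a)) (λ w → bits (φ a) w xor bits (χ a) w)
          ≡⟨ parity-xor G _ _ _ ⟩
        parity G (pos (φ a)) (bits (φ a)) xor parity G (pos (φ a)) (bits (χ a))
          ≡⟨ cong₂ _xor_ parφ (subst (λ c → parity G c (bits (χ a)) ≡ U' c) (χ≗φ a) parχ) ⟩
        U (pos (φ a)) xor U' (pos (φ a))
          ≡⟨ UU' _ ⟩
        U'' (pos (φ a)) ∎

-- Maps over the same map to G are shifted by the same twisted lift of it, if there is one.
-- To make the choice of that lift respect pointwise equality it is made on codes of functions.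
module Shifting (F G : Graph) (U : V G → Bool) where

  open Coded (n G)

  private
    K = cfi G U

  Lifts : (V F → V K) → (V F → V G) → Set
  Lifts χ ψ = IsHom F K χ × (∀ a → pos (χ a) ≡ ψ a)

  CodedLift : Fin (n G ^ n F) → Set
  CodedLift c = ∃ λ e → Lifts (finToFun {n K} {n F} e) (finToFun {n G} {n F} c)

  lift? : ∀ c → Dec (CodedLift c)
  lift? c = any? λ e → isHom? F K (finToFun e) ×-dec (all? λ a → pos (finToFun {n K} {n F} e a) ≟ finToFun c a)

  -- Without a lift the shift is by zero, so that `shifted` is injective on all maps and not only on
  -- those with a lift.
  liftBits : ∀ {c} → Dec (CodedLift c) → V F → V G → Bool
  liftBits (yes (e , _)) a = bits (finToFun {n K} {n F} e a)
  liftBits (no _)        a = λ _ → false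

  offset : Fin (n G ^ n F) → V F → V G → Bool
  offset c = liftBits (lift? c)

  shifted : (V F → Fin (n G * 2 ^ n G)) → V F → Fin (n G * 2 ^ n G)
  shifted φ = shift φ (offset (funToFin (pos ∘ φ)))

  -- Shifting keeps the underlying map to G, hence φ and χ were shifted by the same bits, and these
  -- cancel.
  shifted-inj : ∀ φ χ → shifted φ ≗ shifted χ → φ ≗ χ
  shifted-inj φ χ e a = pos-bits-inj (φ a) (χ a) (pos≡ a) λ w → xor-cancelʳ (oφ a w) (begin
    bits (φ a) w xor oφ a w     ≡⟨ ≡-sym (bits-shift φ oφ a w) ⟩
    bits (shifted φ a) w        ≡⟨ cong (λ z → bits z w) (e a) ⟩
    bits (shifted χ a) w        ≡⟨ bits-shift χ oχ a w ⟩
    bits (χ a) w xor oχ a w     ≡⟨ cong (λ c → bits (χ a) w xor offset c a w) (≡-sym (funToFin-cong pos≡)) ⟩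
    bits (χ a) w xor oφ a w ∎)
    where
    open ≡-Reasoning
    oφ = offset (funToFin (pos ∘ φ))
    oχ = offset (funToFin (pos ∘ χ))
    pos≡ : ∀ a → pos (φ a) ≡ pos (χ a)
    pos≡ a = trans (≡-sym (pos-shift φ oφ a)) (trans (cong pos (e a)) (pos-shift χ oχ a))
    xor-cancelʳ : ∀ {x y} z → x xor z ≡ y xor z → x ≡ y
    xor-cancelʳ {x} {y} z e = trans (≡-sym (undo x)) (trans (cong (_xor z) e) (undo y))
      where
      undo : ∀ x → (x xor z) xor z ≡ x
      undo x = trans (Bool.xor-assoc x z z) (trans (cong (x xor_) (Bool.xor-same z)) (Bool.xor-identityʳ x))

  -- χ only proves that the search succeeds; the shift uses the lift found by the search, which has
  -- the same charge U.
  shifted-hom : ∀ {U' U''} → (∀ u → U' u xor U u ≡ U'' u) → ∀ {φ} → IsHom F (cfi G U') φ →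
    ∀ χ → Lifts χ (pos ∘ φ) → IsHom F (cfi G U'') (shifted φ)
  shifted-hom {U'} {U''} UU' {φ} φ-hom χ (χ-hom , χ≗) with lift? (funToFin (pos ∘ φ))
  ... | no ¬lift = contradiction (funToFin χ , isHom-resp F K (λ a → ≡-sym (finToFun-funToFin χ a)) χ-hom ,
          λ a → trans (cong pos (finToFun-funToFin χ a)) (trans (χ≗ a) (≡-sym (finToFun-funToFin (pos ∘ φ) a)))) ¬lift
  ... | yes (e , e-hom , e≗) =
    shift-hom F G {U'} {U} {U''} UU' φ-hom e-hom (λ a → trans (e≗ a) (finToFun-funToFin (pos ∘ φ) a))

module _ {d : ℕ} {G : Graph} {v : V G} (Φ : Fan (suc d) G v) where

  open Coded (n G)

  private
    δ : V G → Bool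
    δ u = eqF u v

  untwisted twisted : Graph
  untwisted = cfi G (λ _ → false)
  twisted   = cfi G δ

  private
    -- A twisted homomorphism is itself a twisted lift of its projection to G, so a shift always
    -- exists and cancels the charge. Hence for every F the twisted count is at most the untwisted
    -- one.
    module Untwist (F : Graph) = HomInjection {F} {twisted} {untwisted} (Shifting.shifted F G δ)
      (λ φ φ-hom → Shifting.shifted-hom F G δ {δ} {λ _ → false} (λ u → Bool.xor-same (δ u)) φ-hom φ (φ-hom , λ _ → refl))
      (Shifting.shifted-inj F G δ)

  fanFree⇒hom≡ : ∀ F → FanFree d F → hom F untwisted ≡ hom F twisted
  fanFree⇒hom≡ F ff = ≤-antisym (HomInjection.hom-≤ {F} {untwisted} {twisted} shifted to-twisted shifted-inj) (Untwist.hom-≤ F)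
    where
    open Shifting F G δ
    to-twisted : ∀ φ → IsHom F untwisted φ → IsHom F twisted (shifted φ)
    to-twisted φ φ-hom = shifted-hom {λ _ → false} {δ} (λ _ → refl) φ-hom χ (isHom⁺ G δ F edges , pχ)
      where
      τ = fibreTwist ff Φ (pos ∘ φ)
      χ : V F → V twisted
      χ a = pair (pos (φ a)) (bit τ a)
      pχ : ∀ a → pos (χ a) ≡ pos (φ a)
      pχ a = pos-pair (pos (φ a)) (bit τ a)
      bχ : ∀ a → bits (χ a) ≗ bit τ a
      bχ a = bits-pair (pos (φ a)) (bit τ a)
      edges : ∀ a b → adj F a b ≡ true → adj G (pos (χ a)) (pos (χ b)) ≡ true ×
        bits (χ a) (pos (χ b)) ≡ bits (χ b) (pos (χ a)) × parity G (pos (χ a)) (bits (χ a)) ≡ δ (pos (χ a))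
      edges a b ab rewrite pχ a | pχ b =
          proj₁ (cfiAdj⁻ G (λ _ → false) (φ-hom a b ab))
        , trans (bχ a _) (trans (agree τ a b ab) (≡-sym (bχ b _)))
        , trans (parity-cong G _ (bχ a)) (charge τ a)

  -- The section of G itself has no twisted lift, since its charges would sum to 1,
  -- whereas every edge contributes twice.
  twisted<untwisted : hom G twisted < hom G untwisted
  twisted<untwisted = Untwist.hom-< G section section-hom λ φ φ-hom e →
    no-section φ φ-hom λ a → trans (≡-sym (pos-shift φ (Shifting.offset G G δ (funToFin (pos ∘ φ))) a))
      (trans (cong pos (e a)) (pos-pair a (λ _ → false)))
    where
    section : V G → V untwisted
    section a = pair a (λ _ → false)

    section-hom : IsHom G untwisted section
    section-hom = isHom⁺ G (λ _ → false) G edges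
      where
      zeros : ∀ a → bits (section a) ≗ (λ _ → false)
      zeros a = bits-pair a (λ _ → false)
      edges : ∀ a b → adj G a b ≡ true → adj G (pos (section a)) (pos (section b)) ≡ true ×
        bits (section a) (pos (section b)) ≡ bits (section b) (pos (section a)) × parity G (pos (section a)) (bits (section a)) ≡ false
      edges a b ab rewrite pos-pair a (λ _ → false) | pos-pair b (λ _ → false) =
        ab , trans (zeros a b) (≡-sym (zeros b a)) , trans (parity-cong G a (zeros a)) (parity-false G a)

    no-section : ∀ φ → IsHom G twisted φ → ¬ (∀ a → pos (φ a) ≡ a)
    no-section φ φ-hom pφ = true≢false (sum-point (λ _ → true) v)
      (trans (≡-sym (sum-cong-≗ charges)) (sum-symmetric half half-sym half-diag))
      where
      half : V G → V G → Bool
      half a w = adj G a w ∧ bits (φ a) w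
      edge-facts : ∀ a b → adj G a b ≡ true → bits (φ a) b ≡ bits (φ b) a × parity G a (bits (φ a)) ≡ δ a
      edge-facts a b ab with cfiAdj⁻ G δ (φ-hom a b ab)
      ... | _ , b≡ , p≡ rewrite pφ a | pφ b = b≡ , p≡
      half-sym : ∀ a b → half a b ≡ half b a
      half-sym a b rewrite Graph.sym G b a with adj G a b in ab
      ... | false = refl
      ... | true  = proj₁ (edge-facts a b ab)
      half-diag : ∀ a → half a a ≡ false
      half-diag a rewrite loopless G a = refl
      charges : ∀ a → parity G a (bits (φ a)) ≡ δ a
      charges a with any? (λ b → adj G a b Bool.≟ true)
      ... | yes (b , ab) = proj₂ (edge-facts a b ab)
      -- No edge enforces the charge at an isolated a. Its empty parity is 0, and so is its
      -- prescribed charge because v has a spoke.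
      ... | no isolated = trans (sum-false λ w → cong (_∧ bits (φ a) w) (Bool.¬-not λ aw → isolated (w , aw)))
              (≡-sym (≢⇒eqF {i = a} {v} λ { refl → isolated (tip Φ zero , spoke Φ zero) }))

-- Transfer to 1-sums and cacti

fanFree-homDistClosed : ∀ d → HomDistClosed (FanFree d)
fanFree-homDistClosed d G G∉ with ¬FanFree⇒Fan d G G∉
... | v , Φ = untwisted Φ , twisted Φ , fanFree⇒hom≡ Φ , ≢-sym (<⇒≢ (twisted<untwisted Φ))

closed-resp : ∀ {𝓕 𝓖 : GraphClass} → (∀ {G} → 𝓕 G → 𝓖 G) → (∀ {G} → 𝓖 G → 𝓕 G) →
  ClosedUnderWeakOddomorphisms 𝓕 → ClosedUnderWeakOddomorphisms 𝓖
closed-resp to from closed F G φ F∈ weak = to (closed F G φ (from F∈) weak)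

homDistClosed-resp : ∀ {𝓕 𝓖 : GraphClass} → (∀ {G} → 𝓕 G → 𝓖 G) → (∀ {G} → 𝓖 G → 𝓕 G) →
  HomDistClosed 𝓕 → HomDistClosed 𝓖
homDistClosed-resp to from closed G G∉ =
  let K , K' , same , differ = closed G (G∉ ∘ to) in K , K' , (λ F F∈ → same F (from F∈)) , differ

theorem4p10 : (∀ (d : ℕ) → 1 ≤ d → ClosedUnderWeakOddomorphisms (OneSums (MaxDegLe d)) × HomDistClosed (OneSums (MaxDegLe d))) × (ClosedUnderWeakOddomorphisms Cactus × HomDistClosed Cactus)
theorem4p10 =
    (λ d _ → closed-resp (Blocks.fanFree⇒oneSums _) oneSums⇒fanFree (fanFree-closed d)
           , homDistClosed-resp (Blocks.fanFree⇒oneSums _) oneSums⇒fanFree (fanFree-homDistClosed d))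
  , closed-resp fanFree⇒cactus cactus⇒fanFree (fanFree-closed 2)
  , homDistClosed-resp fanFree⇒cactus cactus⇒fanFree (fanFree-homDistClosed 2)
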